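{- Let $\mathbb{A}=\mathbb{F}_q[T]$ and let $H\in\mathbb{A}$ be a nonzero polynomial. Then for every positive integer $k$, $$\varphi_k(H)= \varphi(H)^k \prod_{P \mid H} \left(1-\frac{1}{|P|-1}+\frac{1}{(|P|-1)^2}-\cdots+ (-1)^{k-1}\frac{1}{(|P|-1)^{k-1}}\right),$$ where the product runs over the monic irreducible polynomials $P$ dividing $H$.
   Context: $\mathbb{F}_q$ is a finite field with $q$ elements ($q$ a power of a prime $p$) and $\mathbb{A}=\mathbb{F}_q[T]$. For nonzero $A\in\mathbb{A}$, $|A|=q^{\deg A}$. For $A_1,\dots,A_k\in\mathbb{A}$, $(A_1,\dots,A_k)$ denotes their monic greatest common divisor. The Euler function is $\varphi(H)=|H|\prod_{P\mid H}(1-1/|P|)$ (product over monic irreducible $P$ dividing $H$); it equals the number of residue classes modulo $H$ coprime to $H$. For a positive integer $k$, the $k$-dimensional generalized Euler function is $$\varphi_k(H)=\#\{(H_1,\dots,H_k)\in(\mathbb{A}/H\mathbb{A})^k : (H_1\cdots H_k,H)=1,\ (H_1+\cdots+H_k,H)=1\},$$ i.e. the number of $k$-tuples of residue classes modulo $H$ satisfying these two coprimality conditions. -}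

module Defs where

open import Level using (0ℓ)
open import Data.Nat as ℕ using (ℕ; zero; suc; _∸_)
open import Data.Integer as ℤ using (+_)
open import Data.Rational as ℚ using (ℚ; _/_)
open import Data.List using (List; []; _∷_; _++_; [_]; length; map; foldr)
open import Data.List.Relation.Unary.All using (All)
open import Data.List.Relation.Unary.Unique.Propositional using (Unique)
open import Data.List.Membership.Propositional using (_∈_)
open import Data.Vec as Vec using (Vec)
open import Data.Product using (Σ; ∃; ∃-syntax; _×_; _,_)
open import Data.Sum using (_⊎_)
open import Relation.Nullary using (¬_; yes; no)
open import Relation.Binary.PropositionalEquality using (_≡_)
open import Relation.Binary.Definitions using (DecidableEquality)
open import Algebra.Structures using (IsCommutativeRing)

record FiniteField : Set₁ where
  field
    Carrier  : Set
    _+_ _*_  : Carrier → Carrier → Carrier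
    -_       : Carrier → Carrier
    0# 1#    : Carrier
    isCommutativeRing : IsCommutativeRing _≡_ _+_ _*_ -_ 0# 1#
    0≢1      : ¬ (0# ≡ 1#)
    inverse  : ∀ x → ¬ (x ≡ 0#) → ∃[ y ] (x * y ≡ 1#)
    _≟_      : DecidableEquality Carrier
    elements : List Carrier
    elements-unique   : Unique elements
    elements-complete : ∀ x → x ∈ elements

  q : ℕ
  q = length elements

-- Polynomials in A = F_q[T], as coefficient lists (lowest degree first).

module Poly (F : FiniteField) where
  open FiniteField F

  Poly : Set
  Poly = List Carrier

  _≈ₚ_ : Poly → Poly → Set
  []       ≈ₚ ys       = All (_≡ 0#) ys
  (x ∷ xs) ≈ₚ []       = All (_≡ 0#) (x ∷ xs)
  (x ∷ xs) ≈ₚ (y ∷ ys) = (x ≡ y) × (xs ≈ₚ ys)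

  0ₚ : Poly
  0ₚ = []

  1ₚ : Poly
  1ₚ = 1# ∷ []

  _+ₚ_ : Poly → Poly → Poly
  []       +ₚ ys       = ys
  (x ∷ xs) +ₚ []       = x ∷ xs
  (x ∷ xs) +ₚ (y ∷ ys) = (x + y) ∷ (xs +ₚ ys)

  _*ₚ_ : Poly → Poly → Poly
  []       *ₚ ys = []
  (x ∷ xs) *ₚ ys = map (x *_) ys +ₚ (0# ∷ (xs *ₚ ys))

  sumₚ : List Poly → Poly
  sumₚ = foldr _+ₚ_ 0ₚ

  prodₚ : List Poly → Poly
  prodₚ = foldr _*ₚ_ 1ₚ

  normalize : Poly → Poly
  normalize [] = []
  normalize (x ∷ xs) with normalize xs
  ... | y ∷ ys = x ∷ y ∷ ys
  ... | [] with x ≟ 0#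
  ...   | yes _ = []
  ...   | no  _ = x ∷ []

  -- degree (the degree of 0 is taken to be 0; only used for nonzero H, P)
  deg : Poly → ℕ
  deg p = length (normalize p) ∸ 1

  ∣_∣ₚ : Poly → ℕ
  ∣ p ∣ₚ = q ℕ.^ deg p

  _∣ₚ_ : Poly → Poly → Set
  D ∣ₚ A = ∃[ Q ] ((Q *ₚ D) ≈ₚ A)

  Unit : Poly → Set
  Unit U = U ∣ₚ 1ₚ

  -- monic: leading coefficient 1 (the list representation then has no trailing zeros)
  Monic : Poly → Set
  Monic P = ∃[ xs ] (P ≡ xs ++ [ 1# ])

  Irreducible : Poly → Set
  Irreducible P = ¬ (P ≈ₚ 0ₚ) × ¬ Unit P
                × (∀ A B → (A *ₚ B) ≈ₚ P → Unit A ⊎ Unit B)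

  Coprime : Poly → Poly → Set
  Coprime A B = ∀ D → D ∣ₚ A → D ∣ₚ B → Unit D

  -- residue classes modulo H, represented by their unique representative
  -- of degree < deg H (coefficient vectors of length deg H)
  Residue : Poly → Set
  Residue H = Vec Carrier (deg H)

  PhiKCond : (H : Poly) (k : ℕ) → Vec (Residue H) k → Set
  PhiKCond H k t =
    Coprime (prodₚ (map Vec.toList (Vec.toList t))) H
    × Coprime (sumₚ (map Vec.toList (Vec.toList t))) H

  PhiKIs : (H : Poly) (k : ℕ) → ℕ → Set
  PhiKIs H k n = ∃[ L ] (Unique L
                     × (∀ t → (t ∈ L → PhiKCond H k t) × (PhiKCond H k t → t ∈ L))
                     × length L ≡ n)

  PrimeDivisors : Poly → List Poly → Set
  PrimeDivisors H Ps = Unique Ps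
    × (∀ P → (P ∈ Ps → Monic P × Irreducible P × P ∣ₚ H)
           × (Monic P × Irreducible P × P ∣ₚ H → P ∈ Ps))

fromℕ : ℕ → ℚ
fromℕ n = (+ n) / 1

-- 1/n as a rational; the value at n = 0 is irrelevant (never used:
-- |P| ≥ 2 for irreducible P, so |P| - 1 ≥ 1)
inv : ℕ → ℚ
inv zero    = ℚ.0ℚ
inv (suc n) = (+ 1) / suc n

_^ℚ_ : ℚ → ℕ → ℚ
x ^ℚ zero  = ℚ.1ℚ
x ^ℚ suc n = x ℚ.* (x ^ℚ n)

prodℚ : List ℚ → ℚ
prodℚ = foldr ℚ._*_ ℚ.1ℚ

altSum : ℚ → ℕ → ℚ
altSum x zero    = ℚ.0ℚ
altSum x (suc k) = altSum x k ℚ.+ ((ℚ.- x) ^ℚ k)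

module Formula (F : FiniteField) where
  open Poly F

  eulerPhi : Poly → List Poly → ℚ
  eulerPhi H Ps = fromℕ ∣ H ∣ₚ ℚ.* prodℚ (map (λ P → ℚ.1ℚ ℚ.- inv ∣ P ∣ₚ) Ps)

  rhs : Poly → List Poly → ℕ → ℚ
  rhs H Ps k = (eulerPhi H Ps ^ℚ k)
             ℚ.* prodℚ (map (λ P → altSum (inv (∣ P ∣ₚ ∸ 1)) k) Ps)

{-# OPTIONS --safe #-}
-- Let N_k(P) count the k-tuples of nonzero residues modulo a prime P with nonzero sum. A (k+1)-tuple of
-- nonzero residues either has nonzero sum, or is determined by its tail, whose sum is then nonzero; so
-- N_{k+1}(P) + N_k(P) = (|P| - 1)^{k+1}, and N_k(P) / (|P| - 1)^k is the alternating sum of the statement.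
-- Write H = D E with D the product of the primes dividing H. The coprimality conditions depend only on the
-- tuple modulo D, so φ_k(H) = |E|^k φ_k(D), and φ_k(D) is the product of the N_k(P) by the Chinese remainder
-- theorem. The right-hand side factors in the same way, because |H| = |E| ∏ |P|.
--
-- A residue class is a polynomial up to congruence, and sets of classes are compared by setoid bijections.
module Submission where

open import Defs
open import Level using (0ℓ)
open import Algebra.Bundles using (AbelianGroup; CommutativeRing)
open import Algebra.Structures using (IsAbelianGroup; IsCommutativeRing)
open import Data.Empty using (⊥-elim)
open import Data.Fin.Base using (Fin; zero; suc)
open import Data.Fin.Permutation using (↔⇒≡)
open import Data.Fin.Properties using (+↔⊎; *↔×; 1↔⊤; all?)
open import Data.Integer.Base as ℤ using (ℤ; +_; -[1+_]; _⊖_)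
import Data.Integer.Properties as ℤ
open import Data.List using (List)
open import Data.List.Base as List using ([]; _∷_; _++_; [_]; map; length)
open import Data.List.Membership.Propositional using (_∈_)
open import Data.List.Membership.Propositional.Properties using (∈-lookup; ∈-tabulate⁺; ∈-tabulate⁻)
open import Data.List.Properties using (length-map; length-tabulate; map-++; map-id-local; ∷ʳ-injective)
open import Data.List.Relation.Unary.All as All using (All; []; _∷_)
open import Data.List.Relation.Unary.AllPairs using (AllPairs; []; _∷_)
open import Data.List.Relation.Unary.Any as Any using (here; there)
open import Data.List.Relation.Unary.Any.Properties using (lookup-index)
open import Data.List.Relation.Unary.Unique.Propositional using (Unique)
open import Data.List.Relation.Unary.Unique.Propositional.Properties using (tabulate⁺)
open import Data.Maybe.Base using (Maybe; just; nothing)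
open import Data.Nat using (ℕ; _≤_)
open import Data.Nat.Base as ℕ using (zero; suc; _<_; z≤n; s≤s)
open import Data.Nat.Induction using (<-wellFounded; Acc; acc)
import Data.Nat.Properties as ℕ
open import Data.Product using (∃-syntax; _×_)
open import Data.Product.Base using (Σ; _,_; proj₁; proj₂)
open import Data.Product.Function.NonDependent.Setoid using (_×-inverse_)
open import Data.Product.Relation.Binary.Pointwise.NonDependent using (_×ₛ_) renaming (Pointwise-≡↔≡ to ×-Pointwise-≡↔≡)
open import Data.Rational using (ℚ)
open import Data.Rational.Base as ℚ using (0ℚ; 1ℚ; fromℚᵘ)
import Data.Rational.Properties as ℚ
open import Data.Rational.Solver using (module +-*-Solver)
open import Data.Rational.Unnormalised.Base as ℚᵘ using (mkℚᵘ; *≡*)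
import Data.Rational.Unnormalised.Properties as ℚᵘ
open import Data.Sum.Base using (_⊎_; inj₁; inj₂)
open import Data.Sum.Function.Setoid using (_⊎-inverse_)
open import Data.Sum.Relation.Binary.Pointwise using (_⊎ₛ_; inj₁; inj₂) renaming (Pointwise-≡↔≡ to ⊎-Pointwise-≡↔≡)
open import Data.Unit.Base using (⊤; tt)
open import Data.Vec.Base as Vec using (Vec; []; _∷_; toList; fromList)
open import Data.Vec.Functional using (Vector; head; tail) renaming (_∷_ to _◂_)
open import Data.Vec.Functional.Relation.Binary.Equality.Setoid using (≋-setoid)
open import Data.Vec.Properties using (lookup∘tabulate; tabulate∘lookup; tabulate-cong; toList∘fromList; ≡-dec)
open import Function.Base using (_∘_)
open import Function.Bundles using (Inverse; mk↔ₛ′)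
open import Function.Construct.Composition using () renaming (inverse to compose)
open import Function.Construct.Identity using () renaming (inverse to identity)
open import Function.Construct.Symmetry using () renaming (inverse to flip)
open import Relation.Binary.Bundles using (Setoid)
import Relation.Binary.Construct.On as On
open import Relation.Binary.Definitions using (_Respects_; tri<; tri≈; tri>)
open import Relation.Binary.PropositionalEquality using (_≡_)
import Relation.Binary.PropositionalEquality as ≡
open import Relation.Nullary using (¬_)
open import Relation.Nullary.Decidable as Dec using (Dec; yes; no; ¬?; _×-dec_)
open import Relation.Unary using (Decidable)

-- Working with the product D of the distinct primes keeps prime powers out of the proof: the
-- exponents in H are never determined, and the Chinese remainder theorem is applied only to a prime
-- and a product of other primes. The cofactor E may share primes with D, so that theorem cannot
-- lead from D to H. Instead a = r + q D, with r the canonical remainder, splits a class modulo D E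
-- into the class of r modulo D and the class of q modulo E. Every equation between counts comes
-- from counting one set twice. The recurrence is thus a subtraction-free equation of natural
-- numbers, and it is solved only after passing to the rationals. The primes dividing H are given as
-- a list, so nothing has to be factored. For coprimality it is enough that a nonunit cannot fail to
-- have an irreducible divisor, because being a unit is decided by the degree.

module Finite where

  -- Finite setoids and their cardinalities

  open ≡ using (refl)

  FinSetoid : ℕ → Setoid 0ℓ 0ℓ
  FinSetoid n = ≡.setoid (Fin n)

  infix 1 _≅_
  _≅_ : Setoid 0ℓ 0ℓ → Setoid 0ℓ 0ℓ → Set
  S ≅ T = Inverse S T

  Card : Setoid 0ℓ 0ℓ → ℕ → Set
  Card S n = S ≅ FinSetoid n

  infixr 9 _⨾_
  _⨾_ : ∀ {S T U} → S ≅ T → T ≅ U → S ≅ U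
  _⨾_ = compose

  -- The proof of X is ignored by the equality, so predicates with many proofs, such as negations
  -- and coprimality, still cut out subsets that are counted correctly.
  Sub : (S : Setoid 0ℓ 0ℓ) → (Setoid.Carrier S → Set) → Setoid 0ℓ 0ℓ
  Sub S X = On.setoid {B = Σ (Setoid.Carrier S) X} S proj₁

  -- Tuples are functions on `Fin k`, which makes congruence of tuples pointwise; `pow≅vec` leads
  -- back to the vectors of the statement.
  Pow : Setoid 0ℓ 0ℓ → ℕ → Setoid 0ℓ 0ℓ
  Pow = ≋-setoid

  ⊤ₛ : Setoid 0ℓ 0ℓ
  ⊤ₛ = ≡.setoid ⊤

  private
    variable
      S T : Setoid 0ℓ 0ℓ
      m n : ℕ

  card-unique : Card S m → Card S n → m ≡ n
  card-unique c d = ↔⇒≡ (flip c ⨾ d)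

  card-× : Card S m → Card T n → Card (S ×ₛ T) (m ℕ.* n)
  card-× c d = (c ×-inverse d) ⨾ ×-Pointwise-≡↔≡ ⨾ flip *↔×

  card-⊎ : Card S m → Card T n → Card (S ⊎ₛ T) (m ℕ.+ n)
  card-⊎ {m = m} {n = n} c d = (c ⊎-inverse d) ⨾ ⊎-Pointwise-≡↔≡ (Fin m) (Fin n) ⨾ flip +↔⊎

  card-⊤ : Card ⊤ₛ 1
  card-⊤ = flip 1↔⊤

  contractible : (S : Setoid 0ℓ 0ℓ) (s : Setoid.Carrier S) → (∀ t → Setoid._≈_ S s t) → S ≅ ⊤ₛ
  contractible S s eq = record
    { to        = λ _ → tt
    ; from      = λ _ → s
    ; to-cong   = λ _ → refl
    ; from-cong = λ _ → Setoid.refl S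
    ; inverse   = (λ _ → refl) , (λ {x} _ → eq x)
    }

  sub-cong : ∀ {S T : Setoid 0ℓ 0ℓ} {X : Setoid.Carrier S → Set} {Y : Setoid.Carrier T → Set} (f : S ≅ T) →
             (∀ s → X s → Y (Inverse.to f s)) → (∀ t → Y t → X (Inverse.from f t)) →
             Sub S X ≅ Sub T Y
  sub-cong f X⇒Y Y⇒X = record
    { to        = λ (s , x) → to s , X⇒Y s x
    ; from      = λ (t , y) → from t , Y⇒X t y
    ; to-cong   = to-cong
    ; from-cong = from-cong
    ; inverse   = inverseˡ , inverseʳ
    } where open Inverse f

  -- Without `resp`, the decision could send two equal elements to different summands, and `from`
  -- would not be a map of setoids.
  sub-⊎ : ∀ {S : Setoid 0ℓ 0ℓ} {X : Setoid.Carrier S → Set} → X Respects Setoid._≈_ S → Decidable X →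
          Sub S X ⊎ₛ Sub S (λ s → ¬ X s) ≅ S
  sub-⊎ {S} {X} resp X? = record
    { to        = to
    ; from      = from
    ; to-cong   = to-cong
    ; from-cong = from-cong
    ; inverse   = (λ {x} e → S.trans (to-cong e) (to∘from x))
                , (λ {x} e → ⊎.trans (from-cong e) (from∘to x))
    }
    where
    module S = Setoid S
    module ⊎ = Setoid (Sub S X ⊎ₛ Sub S (λ s → ¬ X s))

    to : ⊎.Carrier → S.Carrier
    to (inj₁ (s , _)) = s
    to (inj₂ (s , _)) = s

    to-cong : ∀ {a b} → a ⊎.≈ b → to a S.≈ to b
    to-cong (inj₁ e) = e
    to-cong (inj₂ e) = e

    from : S.Carrier → ⊎.Carrier
    from s with X? s
    ... | yes x = inj₁ (s , x)
    ... | no ¬x = inj₂ (s , ¬x)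

    from-cong : ∀ {a b} → a S.≈ b → from a ⊎.≈ from b
    from-cong {a} {b} e with X? a | X? b
    ... | yes _ | yes _ = inj₁ e
    ... | yes x | no ¬y = ⊥-elim (¬y (resp e x))
    ... | no ¬x | yes y = ⊥-elim (¬x (resp (S.sym e) y))
    ... | no _  | no _  = inj₂ e

    to∘from : ∀ s → to (from s) S.≈ s
    to∘from s with X? s
    ... | yes _ = S.refl
    ... | no _  = S.refl

    from∘to : ∀ a → from (to a) ⊎.≈ a
    from∘to (inj₁ (s , x)) with X? s
    ... | yes _ = inj₁ S.refl
    ... | no ¬x = ⊥-elim (¬x x)
    from∘to (inj₂ (s , ¬x)) with X? s
    ... | yes x = ⊥-elim (¬x x)
    ... | no _  = inj₂ S.refl

  -- Only the existence of the cardinality matters here. Its value is pinned down afterwards by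
  -- `card-unique`, from a second count.
  card-subFin : ∀ n {X : Fin n → Set} → Decidable X → ∃[ m ] Card (Sub (FinSetoid n) X) m
  card-subFin zero    X? = 0 , record
    { to        = proj₁
    ; from      = λ ()
    ; to-cong   = λ e → e
    ; from-cong = λ { {()} }
    ; inverse   = (λ { {()} }) , (λ { {() , _} })
    }
  card-subFin (suc n) {X} X? with card-subFin n (λ i → X? (suc i)) | X? zero
  ... | m , c | yes x = suc m , iso ⨾ card-⊎ card-⊤ c
    where
    to : Σ (Fin (suc n)) X → ⊤ ⊎ Σ (Fin n) (X ∘ suc)
    to (zero , _)  = inj₁ tt
    to (suc i , y) = inj₂ (i , y)

    from : ⊤ ⊎ Σ (Fin n) (X ∘ suc) → Σ (Fin (suc n)) X
    from (inj₁ _)       = zero , x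
    from (inj₂ (i , y)) = suc i , y

    iso : Sub (FinSetoid (suc n)) X ≅ ⊤ₛ ⊎ₛ Sub (FinSetoid n) (X ∘ suc)
    iso = record
      { to        = to
      ; from      = from
      ; to-cong   = λ { {zero , _} {zero , _} _ → inj₁ refl ; {suc _ , _} {suc _ , _} refl → inj₂ refl }
      ; from-cong = λ { (inj₁ _) → refl ; (inj₂ refl) → refl }
      ; inverse   = (λ { {inj₁ _} {zero , _} _ → inj₁ refl ; {inj₂ _} {suc _ , _} refl → inj₂ refl })
                  , (λ { {zero , _} {inj₁ _} _ → refl ; {suc _ , _} {inj₂ _} (inj₂ refl) → refl })
      }
  ... | m , c | no ¬x = m , iso ⨾ c
    where
    to : Σ (Fin (suc n)) X → Σ (Fin n) (X ∘ suc)
    to (zero , x)  = ⊥-elim (¬x x)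
    to (suc i , y) = i , y

    iso : Sub (FinSetoid (suc n)) X ≅ Sub (FinSetoid n) (X ∘ suc)
    iso = record
      { to        = to
      ; from      = λ (i , y) → suc i , y
      ; to-cong   = λ { {zero , x} _ → ⊥-elim (¬x x) ; {suc _ , _} {zero , _} () ; {suc _ , _} {suc _ , _} refl → refl }
      ; from-cong = λ { refl → refl }
      ; inverse   = (λ { {_} {zero , x} _ → ⊥-elim (¬x x) ; {_} {suc _ , _} refl → refl })
                  , (λ { {zero , x} _ → ⊥-elim (¬x x) ; {suc _ , _} refl → refl })
      }

  card-sub : ∀ {S} {X : Setoid.Carrier S → Set} → Card S n → X Respects Setoid._≈_ S → Decidable X →
             ∃[ m ] Card (Sub S X) m
  card-sub {n} {S} {X} c resp X? with card-subFin n (λ i → X? (Inverse.from c i))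
  ... | m , d = m , sub-cong c (λ s → resp (S.sym (inverseʳ refl))) (λ _ x → x) ⨾ d
    where
    module S = Setoid S
    open Inverse c

  pow-cong : ∀ k → S ≅ T → Pow S k ≅ Pow T k
  pow-cong k f = record
    { to        = λ s i → to (s i)
    ; from      = λ t i → from (t i)
    ; to-cong   = λ e i → to-cong (e i)
    ; from-cong = λ e i → from-cong (e i)
    ; inverse   = (λ e i → inverseˡ (e i)) , (λ e i → inverseʳ (e i))
    } where open Inverse f

  pow-suc : ∀ {S} k → Pow S (suc k) ≅ S ×ₛ Pow S k
  pow-suc {S} k = record
    { to        = λ s → head s , tail s
    ; from      = λ (s , t) → s ◂ t
    ; to-cong   = λ e → e zero , λ i → e (suc i)
    ; from-cong = λ { (e , _) zero → e ; (_ , e) (suc i) → e i }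
    ; inverse   = (λ e → e zero , λ i → e (suc i))
                , (λ { (e , _) zero → e ; (_ , e) (suc i) → e i })
    }

  card-pow : ∀ k → Card S n → Card (Pow S k) (n ℕ.^ k)
  card-pow {S} zero c = contractible (Pow S 0) (λ ()) (λ _ ()) ⨾ card-⊤
  card-pow (suc k) c  = pow-suc k ⨾ card-× c (card-pow k c)

  pow≅vec : ∀ {B : Set} k → Pow (≡.setoid B) k ≅ ≡.setoid (Vec B k)
  pow≅vec k = record
    { to        = Vec.tabulate
    ; from      = Vec.lookup
    ; to-cong   = tabulate-cong
    ; from-cong = λ { refl _ → refl }
    ; inverse   = (λ e → ≡.trans (tabulate-cong e) (tabulate∘lookup _))
                , (λ { {t} refl i → lookup∘tabulate t i })
    }

  module _ {B : Set} where

    -- In a list without repetition an element has one position, so the membership proof given by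
    -- completeness and the one given by `∈-lookup` have the same index. This makes `lookup` a
    -- two-sided inverse.
    index-unique : {xs : List B} → Unique xs → ∀ {x} (p q : x ∈ xs) → p ≡ q
    index-unique (_   ∷ _)  (here refl) (here refl) = refl
    index-unique (x∉ ∷ _)   (here refl) (there q)   = ⊥-elim (All.lookup x∉ q refl)
    index-unique (x∉ ∷ _)   (there p)   (here refl) = ⊥-elim (All.lookup x∉ p refl)
    index-unique (_   ∷ us) (there p)   (there q)   = ≡.cong there (index-unique us p q)

    index-∈-lookup : ∀ (xs : List B) i → Any.index (∈-lookup {xs = xs} i) ≡ i
    index-∈-lookup (x List.∷ xs) zero    = refl
    index-∈-lookup (x List.∷ xs) (suc i) = ≡.cong suc (index-∈-lookup xs i)

    card-complete : (xs : List B) → Unique xs → (∀ x → x ∈ xs) → Card (≡.setoid B) (length xs)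
    card-complete xs unique complete = mk↔ₛ′
      (λ x → Any.index (complete x))
      (List.lookup xs)
      (λ i → ≡.trans (≡.cong Any.index (index-unique unique _ (∈-lookup i))) (index-∈-lookup xs i))
      (λ x → ≡.sym (lookup-index (complete x)))

open Finite

-- A ring solver with integer coefficients for any commutative ring

module Integers (A : CommutativeRing 0ℓ 0ℓ) where

  open import Algebra.Solver.Ring.AlmostCommutativeRing using (fromCommutativeRing; _-Raw-AlmostCommutative⟶_)
  open import Algebra.Properties.Semiring.Mult (CommutativeRing.semiring A) using (×1-homo-*; ×-homo-+) renaming (_×_ to _·_)
  open import Algebra.Properties.AbelianGroup (CommutativeRing.+-abelianGroup A) using (⁻¹-∙-comm; ⁻¹-involutive; ε⁻¹≈ε)
  open import Algebra.Properties.Ring (CommutativeRing.ring A) using (-‿distribˡ-*; -‿distribʳ-*)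
  open CommutativeRing A
  open import Relation.Binary.Reasoning.Setoid setoid

  -- The canonical homomorphism from the integers. With it the solver can see that coefficients
  -- cancel by computing in ℤ, without deciding equality in the ring.
  fromℤ : ℤ → Carrier
  fromℤ (+ n)      = n · 1#
  fromℤ -[1+ n ] = - (suc n · 1#)

  fromℤ-neg : ∀ i → fromℤ (ℤ.- i) ≈ - fromℤ i
  fromℤ-neg (+ zero)    = sym ε⁻¹≈ε
  fromℤ-neg (+ suc n)   = refl
  fromℤ-neg -[1+ n ] = sym (⁻¹-involutive _)

  cancel-1 : ∀ a b → a - b ≈ (1# + a) - (1# + b)
  cancel-1 a b = begin
    a - b                       ≈⟨ +-identityˡ _ ⟨
    0# + (a - b)                ≈⟨ +-congʳ (-‿inverseʳ 1#) ⟨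
    (1# - 1#) + (a - b)         ≈⟨ +-assoc _ _ _ ⟩
    1# + (- 1# + (a - b))       ≈⟨ +-congˡ (+-congˡ (+-comm _ _)) ⟩
    1# + (- 1# + (- b + a))     ≈⟨ +-congˡ (+-assoc _ _ _) ⟨
    1# + (- 1# - b + a)         ≈⟨ +-congˡ (+-comm _ _) ⟩
    1# + (a + (- 1# - b))       ≈⟨ +-assoc _ _ _ ⟨
    1# + a + (- 1# - b)         ≈⟨ +-congˡ (⁻¹-∙-comm 1# b) ⟩
    (1# + a) - (1# + b)         ∎

  fromℤ-⊖ : ∀ m n → fromℤ (m ⊖ n) ≈ m · 1# - n · 1#
  fromℤ-⊖ m       zero    = sym (trans (+-congˡ ε⁻¹≈ε) (+-identityʳ _))
  fromℤ-⊖ zero    (suc n) = sym (+-identityˡ _)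
  fromℤ-⊖ (suc m) (suc n) = begin
    fromℤ (suc m ⊖ suc n)     ≡⟨ ≡.cong fromℤ (ℤ.[1+m]⊖[1+n]≡m⊖n m n) ⟩
    fromℤ (m ⊖ n)             ≈⟨ fromℤ-⊖ m n ⟩
    m · 1# - n · 1#           ≈⟨ cancel-1 _ _ ⟩
    suc m · 1# - suc n · 1#   ∎

  fromℤ-+ : ∀ i j → fromℤ (i ℤ.+ j) ≈ fromℤ i + fromℤ j
  fromℤ-+ (+ m)      (+ n)      = ×-homo-+ 1# m n
  fromℤ-+ (+ m)      -[1+ n ] = fromℤ-⊖ m (suc n)
  fromℤ-+ -[1+ m ] (+ n)      = trans (fromℤ-⊖ n (suc m)) (+-comm _ _)
  fromℤ-+ -[1+ m ] -[1+ n ] = begin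
    - (suc (suc (m ℕ.+ n)) · 1#)      ≡⟨ ≡.cong (λ k → - (k · 1#)) (ℕ.+-suc (suc m) n) ⟨
    - ((suc m ℕ.+ suc n) · 1#)        ≈⟨ -‿cong (×-homo-+ 1# (suc m) (suc n)) ⟩
    - (suc m · 1# + suc n · 1#)       ≈⟨ ⁻¹-∙-comm _ _ ⟨
    - (suc m · 1#) - suc n · 1#       ∎

  fromℤ-*⁺ : ∀ m j → fromℤ (+ m ℤ.* j) ≈ (m · 1#) * fromℤ j
  fromℤ-*⁺ m (+ n) = begin
    fromℤ (+ m ℤ.* + n)        ≡⟨ ≡.cong fromℤ (ℤ.pos-* m n) ⟨
    (m ℕ.* n) · 1#             ≈⟨ ×1-homo-* m n ⟩
    (m · 1#) * (n · 1#)        ∎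
  fromℤ-*⁺ m -[1+ n ] = begin
    fromℤ (+ m ℤ.* ℤ.- + suc n)       ≡⟨ ≡.cong fromℤ (ℤ.neg-distribʳ-* (+ m) (+ suc n)) ⟨
    fromℤ (ℤ.- (+ m ℤ.* + suc n))     ≈⟨ fromℤ-neg (+ m ℤ.* + suc n) ⟩
    - fromℤ (+ m ℤ.* + suc n)         ≈⟨ -‿cong (fromℤ-*⁺ m (+ suc n)) ⟩
    - ((m · 1#) * (suc n · 1#))       ≈⟨ -‿distribʳ-* _ _ ⟩
    (m · 1#) * - (suc n · 1#)         ∎

  fromℤ-* : ∀ i j → fromℤ (i ℤ.* j) ≈ fromℤ i * fromℤ j
  fromℤ-* (+ m)      j = fromℤ-*⁺ m j
  fromℤ-* -[1+ m ] j = begin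
    fromℤ (ℤ.- + suc m ℤ.* j)         ≡⟨ ≡.cong fromℤ (ℤ.neg-distribˡ-* (+ suc m) j) ⟨
    fromℤ (ℤ.- (+ suc m ℤ.* j))       ≈⟨ fromℤ-neg (+ suc m ℤ.* j) ⟩
    - fromℤ (+ suc m ℤ.* j)           ≈⟨ -‿cong (fromℤ-*⁺ (suc m) j) ⟩
    - ((suc m · 1#) * fromℤ j)        ≈⟨ -‿distribˡ-* _ _ ⟩
    - (suc m · 1#) * fromℤ j          ∎

  fromℤ-homo : CommutativeRing.rawRing ℤ.+-*-commutativeRing -Raw-AlmostCommutative⟶ fromCommutativeRing A
  fromℤ-homo = record
    { ⟦_⟧    = fromℤ
    ; +-homo = fromℤ-+
    ; *-homo = fromℤ-*
    ; -‿homo = fromℤ-neg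
    ; 0-homo = refl
    ; 1-homo = +-identityʳ 1#
    }

  -- Distinct integers may have equal images in positive characteristic, so a negative answer
  -- carries no information; the solver stays sound and only misses such identities.
  fromℤ-≟ : ∀ i j → Maybe (fromℤ i ≈ fromℤ j)
  fromℤ-≟ i j with i ℤ.≟ j
  ... | yes i≡j = just (reflexive (≡.cong fromℤ i≡j))
  ... | no  _   = nothing

  open import Algebra.Solver.Ring _ (fromCommutativeRing A) fromℤ-homo fromℤ-≟ public
    using (solve; _:+_; _:*_; _:-_; :-_; _:=_; con)

-- Congruences, the Chinese remainder theorem and refinement of a modulus

module Congruence (A : CommutativeRing 0ℓ 0ℓ) where

  open Integers A

  open CommutativeRing A hiding (zero)
  open import Algebra.Definitions.RawMagma *-rawMagma using (_∣_; _,_; module _∣ʳ_) public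
  open import Algebra.Properties.Semigroup.Divisibility *-semigroup using () renaming (∣ʳ-trans to ∣-trans) public
  open import Algebra.Properties.Magma.Divisibility *-magma using () renaming (∣ʳ-respʳ-≈ to ∣-respʳ; ∣ʳ-respˡ-≈ to ∣-respˡ) public
  open import Algebra.Properties.CommutativeMonoid.Sum +-commutativeMonoid using (sum) public
  open import Algebra.Properties.AbelianGroup +-abelianGroup using (⁻¹-involutive; ε⁻¹≈ε)
  open import Algebra.Properties.CommutativeSemigroup *-commutativeSemigroup using (interchange)
  open import Relation.Binary.Reasoning.Setoid setoid

  infix 4 _≡_⟦_⟧
  -- A record, so that a, b and m can be inferred from the type; the difference `a - b` alone would
  -- not determine a and b.
  record _≡_⟦_⟧ (a b m : Carrier) : Set where
    constructor congruent
    field ∣-difference : m ∣ a - b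
  open _≡_⟦_⟧

  -- Comparing two setoids Mod m would otherwise unfold the ring solver inside these proofs.
  opaque
    ∣-+ : ∀ {m a b} → m ∣ a → m ∣ b → m ∣ a + b
    ∣-+ {m} (p , e) (q , f) = p + q , trans (distribʳ m p q) (+-cong e f)

    ∣-neg : ∀ {m a} → m ∣ a → m ∣ - a
    ∣-neg {m} (p , e) = - p , trans (solve 2 (λ p m → :- p :* m := :- (p :* m)) refl p m) (-‿cong e)

    ∣-*ˡ : ∀ {m a} b → m ∣ a → m ∣ b * a
    ∣-*ˡ {m} b (p , e) = b * p , trans (*-assoc b p m) (*-congˡ e)

    ∣-*ʳ : ∀ {m a} b → m ∣ a → m ∣ a * b
    ∣-*ʳ {m} {a} b d = ∣-respʳ (*-comm b a) (∣-*ˡ b d)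

    ≈⇒≡ : ∀ {a b m} → a ≈ b → a ≡ b ⟦ m ⟧
    ≈⇒≡ {a} {b} {m} e = congruent (0# , trans (zeroˡ m) (sym (trans (+-congʳ e) (-‿inverseʳ b))))

    ≡-sym : ∀ {a b m} → a ≡ b ⟦ m ⟧ → b ≡ a ⟦ m ⟧
    ≡-sym {a} {b} (congruent d) = congruent
      (∣-respʳ (solve 2 (λ a b → :- (a :- b) := b :- a) refl a b) (∣-neg d))

    ≡-trans : ∀ {a b c m} → a ≡ b ⟦ m ⟧ → b ≡ c ⟦ m ⟧ → a ≡ c ⟦ m ⟧
    ≡-trans {a} {b} {c} (congruent d) (congruent e) = congruent
      (∣-respʳ (solve 3 (λ a b c → (a :- b) :+ (b :- c) := a :- c) refl a b c) (∣-+ d e))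

    ≡-+ : ∀ {a b c d m} → a ≡ b ⟦ m ⟧ → c ≡ d ⟦ m ⟧ → a + c ≡ b + d ⟦ m ⟧
    ≡-+ {a} {b} {c} {d} (congruent p) (congruent q) = congruent
      (∣-respʳ (solve 4 (λ a b c d → (a :- b) :+ (c :- d) := (a :+ c) :- (b :+ d)) refl a b c d) (∣-+ p q))

    ≡-neg : ∀ {a b m} → a ≡ b ⟦ m ⟧ → - a ≡ - b ⟦ m ⟧
    ≡-neg {a} {b} (congruent p) = congruent
      (∣-respʳ (solve 2 (λ a b → :- (a :- b) := :- a :- (:- b)) refl a b) (∣-neg p))

    ∣-resp-≡ : ∀ {a b m} → a ≡ b ⟦ m ⟧ → m ∣ a → m ∣ b
    ∣-resp-≡ {a} {b} (congruent d) e =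
      ∣-respʳ (solve 2 (λ a b → a :+ (:- (a :- b)) := b) refl a b) (∣-+ e (∣-neg d))

    ≡-weaken : ∀ {a b l m} → l ∣ m → a ≡ b ⟦ m ⟧ → a ≡ b ⟦ l ⟧
    ≡-weaken l∣m (congruent d) = congruent (∣-trans l∣m d)

    a-0≈a : ∀ a → a - 0# ≈ a
    a-0≈a a = trans (+-congˡ ε⁻¹≈ε) (+-identityʳ a)

    ∣⇒≡0 : ∀ {a m} → m ∣ a → a ≡ 0# ⟦ m ⟧
    ∣⇒≡0 {a} d = congruent (∣-respʳ (sym (a-0≈a a)) d)

    ≡0⇒∣ : ∀ {a m} → a ≡ 0# ⟦ m ⟧ → m ∣ a
    ≡0⇒∣ {a} (congruent d) = ∣-respʳ (a-0≈a a) d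

  Mod : Carrier → Setoid 0ℓ 0ℓ
  Mod m = record
    { Carrier       = Carrier
    ; _≈_           = _≡_⟦ m ⟧
    ; isEquivalence = record { refl = ≈⇒≡ refl ; sym = ≡-sym ; trans = ≡-trans }
    }

  Class : Carrier → ℕ → Setoid 0ℓ 0ℓ
  Class m k = Pow (Mod m) k

  _Respects[_] : ∀ {k} → (Vector Carrier k → Set) → Carrier → Set
  _Respects[_] {k} X m = X Respects (Setoid._≈_ (Class m k))

  class-cong : ∀ {m n k} → m ≈ n → Class m k ≅ Class n k
  class-cong m≈n = record
    { to        = λ t → t
    ; from      = λ t → t
    ; to-cong   = λ e i → resp m≈n (e i)
    ; from-cong = λ e i → resp (sym m≈n) (e i)
    ; inverse   = (λ e i → resp m≈n (e i)) , (λ e i → resp (sym m≈n) (e i))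
    }
    where
    resp : ∀ {m n a b} → m ≈ n → a ≡ b ⟦ m ⟧ → a ≡ b ⟦ n ⟧
    resp e (congruent d) = congruent (∣-respˡ e d)

  ≡-mod-1 : ∀ a b → a ≡ b ⟦ 1# ⟧
  ≡-mod-1 a b = congruent (a - b , *-identityʳ _)

  Comaximal : Carrier → Carrier → Set
  Comaximal m n = ∃[ u ] ∃[ v ] u * m + v * n ≈ 1#

  module _ {m n : Carrier} (comaximal : Comaximal m n) where

    private
      u v : Carrier
      u = proj₁ comaximal
      v = proj₁ (proj₂ comaximal)

      bezout : u * m + v * n ≈ 1#
      bezout = proj₂ (proj₂ comaximal)

    -- By Bézout, `v * n` is 1 modulo m and 0 modulo n, and `u * m` is 0 modulo m and 1 modulo n.
    crt : Carrier → Carrier → Carrier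
    crt a b = a * (v * n) + b * (u * m)

    -- Replacing the subtracted a by `a * (u * m + v * n)` cancels the terms in `v * n` and leaves
    -- the multiple `(b - a) * u` of m.
    crt-≡ˡ : ∀ a b → crt a b ≡ a ⟦ m ⟧
    crt-≡ˡ a b = congruent ((b - a) * u , (begin
      (b - a) * u * m
        ≈⟨ *-assoc _ u m ⟩
      (b - a) * (u * m)
        ≈⟨ solve 4 (λ a b x y → (b :- a) :* x := a :* y :+ b :* x :- a :* (x :+ y)) refl a b (u * m) (v * n) ⟩
      crt a b - a * (u * m + v * n)  ≈⟨ +-congˡ (-‿cong (trans (*-congˡ bezout) (*-identityʳ a))) ⟩
      crt a b - a                    ∎))

    crt-≡ʳ : ∀ a b → crt a b ≡ b ⟦ n ⟧
    crt-≡ʳ a b = congruent ((a - b) * v , (begin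
      (a - b) * v * n
        ≈⟨ *-assoc _ v n ⟩
      (a - b) * (v * n)
        ≈⟨ solve 4 (λ a b x y → (a :- b) :* y := a :* y :+ b :* x :- b :* (x :+ y)) refl a b (u * m) (v * n) ⟩
      crt a b - b * (u * m + v * n)  ≈⟨ +-congˡ (-‿cong (trans (*-congˡ bezout) (*-identityʳ b))) ⟩
      crt a b - b                    ∎))

    -- In a = u m a + v n a, put a = q n into the first term and a = p m into the second; each then
    -- contains m n.
    comaximal-∣ : ∀ {a} → m ∣ a → n ∣ a → m * n ∣ a
    comaximal-∣ {a} (p , pm≈a) (q , qn≈a) = u * q + v * p , (begin
      (u * q + v * p) * (m * n)          ≈⟨ distribʳ _ _ _ ⟩
      u * q * (m * n) + v * p * (m * n)  ≈⟨ +-cong (interchange u q m n) (trans (*-congˡ (*-comm m n)) (interchange v p n m)) ⟩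
      u * m * (q * n) + v * n * (p * m)  ≈⟨ +-cong (*-congˡ qn≈a) (*-congˡ pm≈a) ⟩
      u * m * a + v * n * a              ≈⟨ distribʳ a _ _ ⟨
      (u * m + v * n) * a                ≈⟨ *-congʳ bezout ⟩
      1# * a                             ≈⟨ *-identityˡ a ⟩
      a                                  ∎)

    comaximal-≡ : ∀ {a b} → a ≡ b ⟦ m ⟧ → a ≡ b ⟦ n ⟧ → a ≡ b ⟦ m * n ⟧
    comaximal-≡ (congruent d) (congruent e) = congruent (comaximal-∣ d e)

    chinese-remainder : ∀ {k} {X Y : Vector Carrier k → Set} → X Respects[ m ] → Y Respects[ n ] →
      Sub (Class (m * n) k) (λ t → X t × Y t) ≅ Sub (Class m k) X ×ₛ Sub (Class n k) Y
    chinese-remainder {k} {X} {Y} X-resp Y-resp = record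
      { to        = λ (t , x , y) → (t , x) , (t , y)
      ; from      = λ ((s , x) , (t , y)) → both s t , X-resp (λ i → ≡-sym (crt-≡ˡ (s i) (t i))) x
                                                     , Y-resp (λ i → ≡-sym (crt-≡ʳ (s i) (t i))) y
      ; to-cong   = λ e → (λ i → ≡-weaken m∣mn (e i)) , (λ i → ≡-weaken n∣mn (e i))
      ; from-cong = λ (e , f) i → comaximal-≡
          (≡-trans (crt-≡ˡ _ _) (≡-trans (e i) (≡-sym (crt-≡ˡ _ _))))
          (≡-trans (crt-≡ʳ _ _) (≡-trans (f i) (≡-sym (crt-≡ʳ _ _))))
      ; inverse   = (λ e → (λ i → ≡-trans (≡-weaken m∣mn (e i)) (crt-≡ˡ _ _))
                         , (λ i → ≡-trans (≡-weaken n∣mn (e i)) (crt-≡ʳ _ _)))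
                  , (λ (e , f) i → comaximal-≡ (≡-trans (crt-≡ˡ _ _) (e i)) (≡-trans (crt-≡ʳ _ _) (f i)))
      }
      where
      m∣mn : m ∣ m * n
      m∣mn = n , *-comm n m
      n∣mn : n ∣ m * n
      n∣mn = m , refl
      both : Vector Carrier k → Vector Carrier k → Vector Carrier k
      both s t i = crt (s i) (t i)

  module _ (d : Carrier) (cancel : ∀ a b → a * d ≈ b * d → a ≈ b)
           (rep : Carrier → Carrier) (rep-≡ : ∀ a → a ≡ rep a ⟦ d ⟧)
           (rep-cong : ∀ {a b} → a ≡ b ⟦ d ⟧ → rep a ≈ rep b) where

    private
      quot : Carrier → Carrier
      quot a = _∣ʳ_.quotient (∣-difference (rep-≡ a))

      quot-rep : ∀ a → quot a * d ≈ a - rep a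
      quot-rep a = _∣ʳ_.equality (∣-difference (rep-≡ a))

      combine : Carrier → Carrier → Carrier
      combine r q = rep r + q * d

      combine-≡ : ∀ r q → combine r q ≡ r ⟦ d ⟧
      combine-≡ r q = ≡-sym (congruent (∣-respʳ (solve 3 (λ r s p → (r :- s) :+ (:- p) := r :- (s :+ p)) refl r (rep r) (q * d))
                                     (∣-+ (∣-difference (rep-≡ r)) (∣-neg (q , refl)))))

      combine-quot : ∀ r q → quot (combine r q) ≈ q
      combine-quot r q = cancel _ _ (begin
        quot (combine r q) * d            ≈⟨ quot-rep _ ⟩
        rep r + q * d - rep (combine r q) ≈⟨ +-congˡ (-‿cong (rep-cong (combine-≡ r q))) ⟩
        rep r + q * d - rep r             ≈⟨ solve 2 (λ s p → s :+ p :- s := p) refl (rep r) (q * d) ⟩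
        q * d                             ∎)

      combine-self : ∀ a → combine a (quot a) ≈ a
      combine-self a = trans (+-congˡ (quot-rep a)) (solve 2 (λ a s → s :+ (a :- s) := a) refl a (rep a))

      combine-cong : ∀ {e r s p q} → r ≡ s ⟦ d ⟧ → p ≡ q ⟦ e ⟧ → combine r p ≡ combine s q ⟦ d * e ⟧
      combine-cong {e} {r} {s} {p} {q} r≡s (congruent (z , ze≈p-q)) = congruent (z , (begin
        z * (d * e)                 ≈⟨ solve 3 (λ z d e → z :* (d :* e) := z :* e :* d) refl z d e ⟩
        z * e * d                   ≈⟨ *-congʳ ze≈p-q ⟩
        (p - q) * d                 ≈⟨ solve 4 (λ p q d t → (p :- q) :* d := (t :+ p :* d) :- (t :+ q :* d)) refl p q d (rep s) ⟩
        rep s + p * d - combine s q ≈⟨ +-congʳ (+-congʳ (rep-cong r≡s)) ⟨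
        combine r p - combine s q   ∎))

      quot-cong : ∀ {e a b} → a ≡ b ⟦ d * e ⟧ → quot a ≡ quot b ⟦ e ⟧
      quot-cong {e} {a} {b} (congruent (z , zde≈a-b)) = congruent (z , cancel _ _ (begin
        z * e * d                         ≈⟨ solve 3 (λ z d e → z :* e :* d := z :* (d :* e)) refl z d e ⟩
        z * (d * e)                       ≈⟨ zde≈a-b ⟩
        a - b                             ≈⟨ solve 3 (λ a b t → a :- b := (a :- t) :- (b :- t)) refl a b (rep b) ⟩
        (a - rep b) - (b - rep b)         ≈⟨ +-congʳ (+-congˡ (-‿cong (rep-cong (≡-weaken d∣de (congruent (z , zde≈a-b)))))) ⟨
        (a - rep a) - (b - rep b)         ≈⟨ +-cong (quot-rep a) (-‿cong (quot-rep b)) ⟨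
        quot a * d - quot b * d           ≈⟨ solve 3 (λ p q d → p :* d :- q :* d := (p :- q) :* d) refl (quot a) (quot b) d ⟩
        (quot a - quot b) * d             ∎))
        where
        d∣de : d ∣ d * e
        d∣de = e , *-comm e d

    -- Here d and e may have common factors, so each coordinate is split as `rep a + quot a * d`.
    -- Congruent elements have equal representatives, not merely congruent ones; hence a change of a
    -- by a multiple of d e changes the quotient by a multiple of e, and conversely. The condition X
    -- sees only the part modulo d.
    refine : ∀ {k} e {X : Vector Carrier k → Set} → X Respects[ d ] →
             Sub (Class (d * e) k) X ≅ Sub (Class d k) X ×ₛ Class e k
    refine {k} e {X} X-resp = record
      { to        = λ (t , x) → (t , x) , λ i → quot (t i)
      ; from      = λ ((r , x) , q) → (λ i → combine (r i) (q i)) , X-resp (λ i → ≡-sym (combine-≡ (r i) (q i))) x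
      ; to-cong   = λ eq → (λ i → ≡-weaken d∣de (eq i)) , (λ i → quot-cong (eq i))
      ; from-cong = λ (eq , eq′) i → combine-cong (eq i) (eq′ i)
      ; inverse   = (λ eq → (λ i → ≡-trans (≡-weaken d∣de (eq i)) (combine-≡ _ _))
                          , (λ i → ≡-trans (quot-cong (eq i)) (≈⇒≡ (combine-quot _ _))))
                  , (λ {t} (eq , eq′) i → ≡-trans (combine-cong (eq i) (eq′ i)) (≈⇒≡ (combine-self (proj₁ t i))))
      }
      where
      d∣de : d ∣ d * e
      d∣de = e , *-comm e d

  sum-≡ : ∀ {m} k {s t : Vector Carrier k} → (∀ i → s i ≡ t i ⟦ m ⟧) → sum s ≡ sum t ⟦ m ⟧
  sum-≡ zero    e = ≈⇒≡ refl
  sum-≡ (suc k) e = ≡-+ (e zero) (sum-≡ k (λ i → e (suc i)))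

  -- Tuples modulo one element: the recurrence for good tuples

  module _ (p : Carrier) where

    Avoids : ∀ {k} → Vector Carrier k → Set
    Avoids t = ∀ i → ¬ p ∣ t i

    -- The condition of φ_k localised at p. That p divides no entry stands for p not dividing the
    -- product, which is the same when p is irreducible.
    Good : ∀ {k} → Vector Carrier k → Set
    Good t = Avoids t × ¬ p ∣ sum t

    avoids-resp : ∀ {k} → Avoids {k} Respects[ p ]
    avoids-resp e av i p∣t = av i (∣-resp-≡ (≡-sym (e i)) p∣t)

    good-resp : ∀ {k} → Good {k} Respects[ p ]
    good-resp {k} e (av , s) = avoids-resp e av , s ∘ ∣-resp-≡ (≡-sym (sum-≡ k e))

    module _ (p∣? : ∀ a → Dec (p ∣ a)) where

      multiples≅⊤ : Sub (Mod p) (p ∣_) ≅ ⊤ₛ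
      multiples≅⊤ = contractible _ (0# , 0# , zeroˡ p) (λ (_ , d) → ≡-sym (∣⇒≡0 d))

      -- The multiples of p form a single class. The complement has some cardinality, and counting
      -- all classes as one plus that number identifies it as n.
      card-nonmultiples : ∀ {n} → Card (Mod p) (suc n) → Card (Sub (Mod p) (λ a → ¬ p ∣ a)) n
      card-nonmultiples {n} c = ≡.subst (Card nonmultiples) (ℕ.suc-injective (card-unique total c)) (proj₂ units)
        where
        nonmultiples : Setoid 0ℓ 0ℓ
        nonmultiples = Sub (Mod p) (λ a → ¬ p ∣ a)

        units : ∃[ m ] Card nonmultiples m
        units = card-sub {X = λ a → ¬ p ∣ a} c (λ e ¬d d → ¬d (∣-resp-≡ (≡-sym e) d)) (λ a → ¬? (p∣? a))

        total : Card (Mod p) (suc (proj₁ units))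
        total = flip (sub-⊎ {X = p ∣_} ∣-resp-≡ p∣?) ⨾ card-⊎ (multiples≅⊤ ⨾ card-⊤) (proj₂ units)

      card-avoids : ∀ {n} k → Card (Mod p) (suc n) → Card (Sub (Class p k) Avoids) (n ℕ.^ k)
      card-avoids k c = unzip ⨾ card-pow k (card-nonmultiples c)
        where
        unzip : Sub (Class p k) Avoids ≅ Pow (Sub (Mod p) (λ a → ¬ p ∣ a)) k
        unzip = record
          { to        = λ (t , av) i → t i , av i
          ; from      = λ t → (λ i → proj₁ (t i)) , (λ i → proj₂ (t i))
          ; to-cong   = λ e → e
          ; from-cong = λ e → e
          ; inverse   = (λ e → e) , (λ e → e)
          }

      -- The inverse prepends `- sum t`: the total becomes 0, and the new entry avoids p because
      -- `sum t` does. Conversely, if p divided the sum of the tail as well as the total, it would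
      -- divide the head.
      good-zero-sum : ∀ k → Sub (Sub (Class p (suc k)) Avoids) (λ (t , _) → p ∣ sum t) ≅ Sub (Class p k) Good
      good-zero-sum k = record
        { to        = λ ((t , av) , p∣Σt) → tail t , av ∘ suc , λ p∣Σ → av zero (∣-cancelʳ p∣Σ p∣Σt)
        ; from      = λ (t , av , p∤Σ) → ((- sum t ◂ t) , avoids-neg-sum t av p∤Σ)
                                       , ∣-respʳ (sym (-‿inverseˡ (sum t))) (0# , zeroˡ p)
        ; to-cong   = λ e i → e (suc i)
        ; from-cong = λ e → λ { zero → ≡-neg (sum-≡ k e) ; (suc i) → e i }
        ; inverse   = (λ e i → e (suc i))
                    , (λ { {(t , _) , p∣Σt} e zero → ≡-trans (≡-neg (sum-≡ k e)) (neg-tail t p∣Σt)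
                         ; e (suc i) → e i })
        }
        where
        ∣-cancelʳ : ∀ {a b} → p ∣ b → p ∣ a + b → p ∣ a
        ∣-cancelʳ {a} {b} p∣b p∣a+b = ∣-respʳ (solve 2 (λ a b → a :+ b :- b := a) refl a b) (∣-+ p∣a+b (∣-neg p∣b))

        avoids-neg-sum : ∀ (t : Vector Carrier k) → Avoids t → ¬ p ∣ sum t → Avoids (- sum t ◂ t)
        avoids-neg-sum t av p∤Σ zero    = p∤Σ ∘ ∣-respʳ (⁻¹-involutive (sum t)) ∘ ∣-neg
        avoids-neg-sum t av p∤Σ (suc i) = av i

        neg-tail : ∀ (t : Vector Carrier (suc k)) → p ∣ sum t → - sum (tail t) ≡ head t ⟦ p ⟧
        neg-tail t p∣Σt = ≡-sym (congruent (∣-respʳ (solve 2 (λ a b → a :+ b := a :- (:- b)) refl (head t) (sum (tail t))) p∣Σt))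

      good-suc : ∀ k → Sub (Class p k) Good ⊎ₛ Sub (Class p (suc k)) Good ≅ Sub (Class p (suc k)) Avoids
      good-suc k = (flip (good-zero-sum k) ⊎-inverse regroup)
                 ⨾ sub-⊎ (λ e → ∣-resp-≡ (sum-≡ (suc k) e)) (λ (t , _) → p∣? (sum t))
        where
        regroup : Sub (Class p (suc k)) Good ≅ Sub (Sub (Class p (suc k)) Avoids) (λ (t , _) → ¬ p ∣ sum t)
        regroup = record
          { to        = λ (t , av , p∤Σ) → (t , av) , p∤Σ
          ; from      = λ ((t , av) , p∤Σ) → t , av , p∤Σ
          ; to-cong   = λ e → e
          ; from-cong = λ e → e
          ; inverse   = (λ e → e) , (λ e → e)
          }

      avoids? : ∀ {k} (t : Vector Carrier k) → Dec (Avoids t)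
      avoids? t = all? (λ i → ¬? (p∣? (t i)))

      opaque
        -- Opaque, so that later proofs know this number only through its `Card` and never unfold
        -- the enumeration behind it.
        card-good : ∀ {n} → Card (Mod p) n → ∀ k → ∃[ g ] Card (Sub (Class p k) Good) g
        card-good c k = card-sub (card-pow k c) good-resp (λ t → avoids? t ×-dec ¬? (p∣? (sum t)))

      good-recurrence : ∀ {n g g′} k → Card (Mod p) (suc n) →
                        Card (Sub (Class p k) Good) g → Card (Sub (Class p (suc k)) Good) g′ →
                        g ℕ.+ g′ ≡.≡ n ℕ.^ suc k
      good-recurrence k c d d′ = card-unique (flip (good-suc k) ⨾ card-⊎ d d′) (card-avoids (suc k) c)

      -- The empty sum is 0, a multiple of p, so the empty tuple is not good. This starts the
      -- recurrence and agrees with the empty alternating sum.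
      card-good-0 : ∀ {g} → Card (Sub (Class p 0) Good) g → g ≡.≡ 0
      card-good-0 {zero}  c = ≡.refl
      card-good-0 {suc g} c with Inverse.from c zero
      ... | _ , _ , p∤0 = ⊥-elim (p∤0 (0# , zeroˡ p))

-- Rational arithmetic and the alternating sum

module Rationals where

  open +-*-Solver
  open ≡ using (refl; sym; trans; cong; cong₂; module ≡-Reasoning)
  open ≡-Reasoning
  open import Data.Rational.Base using (_+_; _*_; _-_; -_)

  -- `fromℕ` and `inv` reduce their fractions to lowest terms. Identities between them are therefore
  -- checked on unnormalised fractions, by cross-multiplication, and carried over by this
  -- homomorphism.
  fromℚᵘ-+ : ∀ p q → fromℚᵘ (p ℚᵘ.+ q) ≡ fromℚᵘ p + fromℚᵘ q
  fromℚᵘ-+ p q = ℚ.toℚᵘ-injective (ℚᵘ.≃-trans (ℚ.toℚᵘ-fromℚᵘ (p ℚᵘ.+ q)) (ℚᵘ.≃-sym (ℚᵘ.≃-trans (ℚ.toℚᵘ-homo-+ (fromℚᵘ p) (fromℚᵘ q))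
    (ℚᵘ.+-cong (ℚ.toℚᵘ-fromℚᵘ p) (ℚ.toℚᵘ-fromℚᵘ q)))))

  fromℚᵘ-* : ∀ p q → fromℚᵘ (p ℚᵘ.* q) ≡ fromℚᵘ p * fromℚᵘ q
  fromℚᵘ-* p q = ℚ.toℚᵘ-injective (ℚᵘ.≃-trans (ℚ.toℚᵘ-fromℚᵘ (p ℚᵘ.* q)) (ℚᵘ.≃-sym (ℚᵘ.≃-trans (ℚ.toℚᵘ-homo-* (fromℚᵘ p) (fromℚᵘ q))
    (ℚᵘ.*-cong (ℚ.toℚᵘ-fromℚᵘ p) (ℚ.toℚᵘ-fromℚᵘ q)))))

  fromℕ-+ : ∀ m n → fromℕ (m ℕ.+ n) ≡ fromℕ m + fromℕ n
  fromℕ-+ m n = trans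
    (ℚ.fromℚᵘ-cong {mkℚᵘ (+ (m ℕ.+ n)) 0} {mkℚᵘ (+ m) 0 ℚᵘ.+ mkℚᵘ (+ n) 0}
      (*≡* (cong (ℤ._* + 1) (sym (cong₂ ℤ._+_ (ℤ.*-identityʳ (+ m)) (ℤ.*-identityʳ (+ n)))))))
    (fromℚᵘ-+ (mkℚᵘ (+ m) 0) (mkℚᵘ (+ n) 0))

  fromℕ-* : ∀ m n → fromℕ (m ℕ.* n) ≡ fromℕ m * fromℕ n
  fromℕ-* m n = trans
    (ℚ.fromℚᵘ-cong {mkℚᵘ (+ (m ℕ.* n)) 0} {mkℚᵘ (+ m) 0 ℚᵘ.* mkℚᵘ (+ n) 0}
      (*≡* (cong (ℤ._* + 1) (ℤ.pos-* m n))))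
    (fromℚᵘ-* (mkℚᵘ (+ m) 0) (mkℚᵘ (+ n) 0))

  fromℕ-^ : ∀ m k → fromℕ (m ℕ.^ k) ≡ fromℕ m ^ℚ k
  fromℕ-^ m zero    = refl
  fromℕ-^ m (suc k) = trans (fromℕ-* m (m ℕ.^ k)) (cong (fromℕ m *_) (fromℕ-^ m k))

  fromℕ*inv : ∀ n → fromℕ (suc n) * inv (suc n) ≡ 1ℚ
  fromℕ*inv n = trans (sym (fromℚᵘ-* (mkℚᵘ (+ suc n) 0) (mkℚᵘ (+ 1) n)))
    (ℚ.fromℚᵘ-cong {mkℚᵘ (+ suc n) 0 ℚᵘ.* mkℚᵘ (+ 1) n} {mkℚᵘ (+ 1) 0}
      (*≡* (cong +_ (trans (ℕ.*-identityʳ _) (trans (ℕ.*-identityʳ (suc n)) (sym (trans (ℕ.*-identityˡ (suc (n ℕ.+ 0))) (cong suc (ℕ.+-identityʳ n)))))))))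

  fromℕ-pred : ∀ n → fromℕ (suc n) * (1ℚ - inv (suc n)) ≡ fromℕ n
  fromℕ-pred n = begin
    fromℕ (suc n) * (1ℚ - inv (suc n))
      ≡⟨ solve 2 (λ a i → a :* (con 1ℚ :- i) := a :- a :* i) refl (fromℕ (suc n)) (inv (suc n)) ⟩
    fromℕ (suc n) - fromℕ (suc n) * inv (suc n)
      ≡⟨ cong₂ _-_ (fromℕ-+ 1 n) (fromℕ*inv n) ⟩
    1ℚ + fromℕ n - 1ℚ
      ≡⟨ solve 1 (λ a → con 1ℚ :+ a :- con 1ℚ := a) refl (fromℕ n) ⟩
    fromℕ n ∎

  -- `altSum` appends its last power, whereas the recurrence produces the Horner form, which splits
  -- off the leading 1.
  altSum-suc : ∀ x k → altSum x (suc k) ≡ 1ℚ - x * altSum x k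
  altSum-suc x zero    = solve 1 (λ x → con 0ℚ :+ con 1ℚ := con 1ℚ :- x :* con 0ℚ) refl x
  altSum-suc x (suc k) = begin
    altSum x (suc k) + - x * (- x) ^ℚ k
      ≡⟨ cong (_+ - x * (- x) ^ℚ k) (altSum-suc x k) ⟩
    1ℚ - x * altSum x k + - x * (- x) ^ℚ k
      ≡⟨ solve 3 (λ x s p → con 1ℚ :- x :* s :+ :- x :* p := con 1ℚ :- x :* (s :+ p)) refl x (altSum x k) ((- x) ^ℚ k) ⟩
    1ℚ - x * altSum x (suc k) ∎

  ^ℚ-distrib-* : ∀ x y k → (x * y) ^ℚ k ≡ x ^ℚ k * y ^ℚ k
  ^ℚ-distrib-* x y zero    = refl
  ^ℚ-distrib-* x y (suc k) = trans (cong (x * y *_) (^ℚ-distrib-* x y k))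
    (solve 4 (λ x y a b → x :* y :* (a :* b) := x :* a :* (y :* b)) refl x y (x ^ℚ k) (y ^ℚ k))

  prodℚ-^-* : ∀ {B : Set} (f g : B → ℚ) k bs →
              prodℚ (map (λ b → f b ^ℚ k * g b) bs) ≡ prodℚ (map f bs) ^ℚ k * prodℚ (map g bs)
  prodℚ-^-* f g k []       = sym (trans (ℚ.*-identityʳ _) (one k))
    where
    one : ∀ k → 1ℚ ^ℚ k ≡ 1ℚ
    one zero    = refl
    one (suc k) = trans (ℚ.*-identityˡ _) (one k)
  prodℚ-^-* f g k (b ∷ bs) = begin
    f b ^ℚ k * g b * prodℚ (map (λ b → f b ^ℚ k * g b) bs)
      ≡⟨ cong (f b ^ℚ k * g b *_) (prodℚ-^-* f g k bs) ⟩
    f b ^ℚ k * g b * (F ^ℚ k * G)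
      ≡⟨ solve 4 (λ x y z w → x :* y :* (z :* w) := x :* z :* (y :* w)) refl (f b ^ℚ k) (g b) (F ^ℚ k) G ⟩
    f b ^ℚ k * F ^ℚ k * (g b * G)
      ≡⟨ cong (_* (g b * G)) (^ℚ-distrib-* (f b) F k) ⟨
    (f b * F) ^ℚ k * (g b * G) ∎
    where
    F G : ℚ
    F = prodℚ (map f bs)
    G = prodℚ (map g bs)

  -- Solves the recurrence g k + g (k + 1) = m ^ (k + 1) with g 0 = 0.
  alternating-recurrence : ∀ m (g : ℕ → ℕ) → g 0 ≡ 0 → (∀ k → g k ℕ.+ g (suc k) ≡ suc m ℕ.^ suc k) →
                           ∀ k → fromℕ (g k) ≡ fromℕ (suc m) ^ℚ k * altSum (inv (suc m)) k
  alternating-recurrence m g g0 step zero = cong fromℕ g0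
  alternating-recurrence m g g0 step (suc k) = begin
    fromℕ (g (suc k))
      ≡⟨ solve 2 (λ a b → b := a :+ b :- a) refl (fromℕ (g k)) (fromℕ (g (suc k))) ⟩
    fromℕ (g k) + fromℕ (g (suc k)) - fromℕ (g k)
      ≡⟨ cong₂ _-_ (trans (sym (fromℕ-+ (g k) _)) (trans (cong fromℕ (step k)) (fromℕ-^ (suc m) (suc k))))
                   (alternating-recurrence m g g0 step k) ⟩
    M * M ^ℚ k - M ^ℚ k * S
      -- A factor 1 is made visible in order to be replaced by `M * I`; then `M * M ^ℚ k` can be
      -- taken out of both terms.
      ≡⟨ solve 3 (λ M P S → M :* P :- P :* S := M :* P :- con 1ℚ :* (P :* S)) refl M (M ^ℚ k) S ⟩
    M * M ^ℚ k - 1ℚ * (M ^ℚ k * S)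
      ≡⟨ cong (λ u → M * M ^ℚ k - u * (M ^ℚ k * S)) (fromℕ*inv m) ⟨
    M * M ^ℚ k - M * I * (M ^ℚ k * S)
      ≡⟨ solve 4 (λ M P S I → M :* P :- M :* I :* (P :* S) := M :* P :* (con 1ℚ :- I :* S)) refl M (M ^ℚ k) S I ⟩
    M * M ^ℚ k * (1ℚ - I * S)
      ≡⟨ cong (M * M ^ℚ k *_) (altSum-suc I k) ⟨
    M * M ^ℚ k * altSum I (suc k) ∎
    where
    M I S : ℚ
    M = fromℕ (suc m)
    I = inv (suc m)
    S = altSum I k

open Rationals

-- Coefficient lists as a commutative ring

module Polynomials (F : FiniteField) where

  open FiniteField F using (Carrier; isCommutativeRing)
  open Poly F using (Poly; _≈ₚ_; 0ₚ; 1ₚ; _+ₚ_; _*ₚ_)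

  K : CommutativeRing 0ℓ 0ℓ
  K = record { isCommutativeRing = isCommutativeRing }

  private module K = CommutativeRing K
  open K using (0#; 1#)

  -- The value 0 past the end makes trailing zeros invisible. Equality of all coefficients is thus
  -- `_≈ₚ_` in another form, in which the additive laws reduce to those of the field.
  coeff : Poly → ℕ → Carrier
  coeff []       _       = 0#
  coeff (x ∷ _)  zero    = x
  coeff (_ ∷ xs) (suc n) = coeff xs n

  infix 4 _≋_
  -- A record, so that p and q can be inferred from p ≋ q.
  record _≋_ (p q : Poly) : Set where
    constructor pointwise
    field at : ∀ n → coeff p n ≡ coeff q n
  open _≋_ public

  ≋-refl : ∀ {p} → p ≋ p
  ≋-refl .at _ = ≡.refl

  ≋-sym : ∀ {p q} → p ≋ q → q ≋ p
  ≋-sym e .at n = ≡.sym (e .at n)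

  ≋-trans : ∀ {p q r} → p ≋ q → q ≋ r → p ≋ r
  ≋-trans e f .at n = ≡.trans (e .at n) (f .at n)

  ∷-cong : ∀ {x y p q} → x ≡ y → p ≋ q → x ∷ p ≋ y ∷ q
  ∷-cong e f .at zero    = e
  ∷-cong e f .at (suc n) = f .at n

  ≋-tail : ∀ {x y p q} → x ∷ p ≋ y ∷ q → p ≋ q
  ≋-tail e .at n = e .at (suc n)

  ∷-zero : ∀ {x p} → x ≡ 0# → p ≋ [] → x ∷ p ≋ []
  ∷-zero e f .at zero    = e
  ∷-zero e f .at (suc n) = f .at n

  zeros⇒≋ : ∀ {p} → All (_≡ 0#) p → p ≋ []
  zeros⇒≋ []       = ≋-refl
  zeros⇒≋ (e ∷ es) = ∷-zero e (zeros⇒≋ es)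

  ≋⇒zeros : ∀ p → p ≋ [] → All (_≡ 0#) p
  ≋⇒zeros []      e = []
  ≋⇒zeros (x ∷ p) e = e .at 0 ∷ ≋⇒zeros p (pointwise λ n → e .at (suc n))

  ≈ₚ⇒≋ : ∀ {p q} → p ≈ₚ q → p ≋ q
  ≈ₚ⇒≋ {[]}    {q}     e       = ≋-sym (zeros⇒≋ e)
  ≈ₚ⇒≋ {x ∷ p} {[]}    e       = zeros⇒≋ e
  ≈ₚ⇒≋ {x ∷ p} {y ∷ q} (e , f) = ∷-cong e (≈ₚ⇒≋ f)

  ≋⇒≈ₚ : ∀ {p q} → p ≋ q → p ≈ₚ q
  ≋⇒≈ₚ {[]}    {q}     e = ≋⇒zeros q (≋-sym e)
  ≋⇒≈ₚ {x ∷ p} {[]}    e = ≋⇒zeros (x ∷ p) e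
  ≋⇒≈ₚ {x ∷ p} {y ∷ q} e = e .at 0 , ≋⇒≈ₚ (≋-tail e)

  coeff-+ : ∀ p q n → coeff (p +ₚ q) n ≡ coeff p n K.+ coeff q n
  coeff-+ []      q       n       = ≡.sym (K.+-identityˡ _)
  coeff-+ (x ∷ p) []      n       = ≡.sym (K.+-identityʳ _)
  coeff-+ (x ∷ p) (y ∷ q) zero    = ≡.refl
  coeff-+ (x ∷ p) (y ∷ q) (suc n) = coeff-+ p q n

  coeff-map : ∀ (f : Carrier → Carrier) → f 0# ≡ 0# → ∀ p n → coeff (map f p) n ≡ f (coeff p n)
  coeff-map f f0≡0 []      n       = ≡.sym f0≡0
  coeff-map f f0≡0 (x ∷ p) zero    = ≡.refl
  coeff-map f f0≡0 (x ∷ p) (suc n) = coeff-map f f0≡0 p n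

  scale : Carrier → Poly → Poly
  scale c = map (c K.*_)

  coeff-scale : ∀ c p n → coeff (scale c p) n ≡ c K.* coeff p n
  coeff-scale c = coeff-map (c K.*_) (K.zeroʳ c)

  infix 25 -ₚ_
  -ₚ_ : Poly → Poly
  -ₚ_ = map (K.-_)

  coeff-neg : ∀ p n → coeff (-ₚ p) n ≡ K.- coeff p n
  coeff-neg = coeff-map K.-_ ε⁻¹≈ε
    where open import Algebra.Properties.Group K.+-group using (ε⁻¹≈ε)

  +ₚ-cong : ∀ {p q r s} → p ≋ q → r ≋ s → p +ₚ r ≋ q +ₚ s
  +ₚ-cong {p} {q} {r} {s} e f .at n = begin
    coeff (p +ₚ r) n          ≡⟨ coeff-+ p r n ⟩
    coeff p n K.+ coeff r n   ≡⟨ ≡.cong₂ K._+_ (e .at n) (f .at n) ⟩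
    coeff q n K.+ coeff s n   ≡⟨ coeff-+ q s n ⟨
    coeff (q +ₚ s) n          ∎
    where open ≡.≡-Reasoning

  +ₚ-assoc : ∀ p q r → (p +ₚ q) +ₚ r ≋ p +ₚ (q +ₚ r)
  +ₚ-assoc p q r .at n = begin
    coeff ((p +ₚ q) +ₚ r) n                     ≡⟨ coeff-+ (p +ₚ q) r n ⟩
    coeff (p +ₚ q) n K.+ coeff r n              ≡⟨ ≡.cong (K._+ _) (coeff-+ p q n) ⟩
    coeff p n K.+ coeff q n K.+ coeff r n       ≡⟨ K.+-assoc _ _ _ ⟩
    coeff p n K.+ (coeff q n K.+ coeff r n)     ≡⟨ ≡.cong (_ K.+_) (coeff-+ q r n) ⟨
    coeff p n K.+ coeff (q +ₚ r) n              ≡⟨ coeff-+ p (q +ₚ r) n ⟨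
    coeff (p +ₚ (q +ₚ r)) n                     ∎
    where open ≡.≡-Reasoning

  +ₚ-comm : ∀ p q → p +ₚ q ≋ q +ₚ p
  +ₚ-comm p q .at n = ≡.trans (coeff-+ p q n) (≡.trans (K.+-comm _ _) (≡.sym (coeff-+ q p n)))

  +ₚ-identityʳ : ∀ p → p +ₚ [] ≋ p
  +ₚ-identityʳ []      = ≋-refl
  +ₚ-identityʳ (x ∷ p) = ≋-refl

  -ₚ-cong : ∀ {p q} → p ≋ q → -ₚ p ≋ -ₚ q
  -ₚ-cong {p} {q} e .at n = ≡.trans (coeff-neg p n) (≡.trans (≡.cong K.-_ (e .at n)) (≡.sym (coeff-neg q n)))

  -ₚ-inverseʳ : ∀ p → p +ₚ -ₚ p ≋ []
  -ₚ-inverseʳ p .at n =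
    ≡.trans (coeff-+ p (-ₚ p) n) (≡.trans (≡.cong (coeff p n K.+_) (coeff-neg p n)) (K.-‿inverseʳ _))

  +ₚ-isAbelianGroup : IsAbelianGroup _≋_ _+ₚ_ [] -ₚ_
  +ₚ-isAbelianGroup = record
    { isGroup = record
      { isMonoid = record
        { isSemigroup = record
          { isMagma = record
            { isEquivalence = record { refl = ≋-refl ; sym = ≋-sym ; trans = ≋-trans }
            ; ∙-cong        = +ₚ-cong
            }
          ; assoc = +ₚ-assoc
          }
        ; identity = (λ _ → ≋-refl) , +ₚ-identityʳ
        }
      ; inverse = (λ p → ≋-trans (+ₚ-comm (-ₚ p) p) (-ₚ-inverseʳ p)) , -ₚ-inverseʳ
      ; ⁻¹-cong = -ₚ-cong
      }
    ; comm = +ₚ-comm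
    }

  private
    +ₚ-abelianGroup : AbelianGroup 0ℓ 0ℓ
    +ₚ-abelianGroup = record { isAbelianGroup = +ₚ-isAbelianGroup }

    module + = AbelianGroup +ₚ-abelianGroup
    open import Algebra.Properties.CommutativeSemigroup +.commutativeSemigroup using (interchange; x∙yz≈y∙xz)
    open import Relation.Binary.Reasoning.Setoid +.setoid

  scale-cong : ∀ {c d p q} → c ≡ d → p ≋ q → scale c p ≋ scale d q
  scale-cong {c} {d} {p} {q} e f .at n =
    ≡.trans (coeff-scale c p n) (≡.trans (≡.cong₂ K._*_ e (f .at n)) (≡.sym (coeff-scale d q n)))

  scale-+ₚ : ∀ c p q → scale c (p +ₚ q) ≋ scale c p +ₚ scale c q
  scale-+ₚ c []      q       = ≋-refl
  scale-+ₚ c (x ∷ p) []      = ≋-refl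
  scale-+ₚ c (x ∷ p) (y ∷ q) = ∷-cong (K.distribˡ c x y) (scale-+ₚ c p q)

  scale-* : ∀ c d p → scale (c K.* d) p ≋ scale c (scale d p)
  scale-* c d []      = ≋-refl
  scale-* c d (x ∷ p) = ∷-cong (K.*-assoc c d x) (scale-* c d p)

  scale-0 : ∀ p → scale 0# p ≋ []
  scale-0 []      = ≋-refl
  scale-0 (x ∷ p) = ∷-zero (K.zeroˡ x) (scale-0 p)

  scale-1 : ∀ p → scale 1# p ≋ p
  scale-1 []      = ≋-refl
  scale-1 (x ∷ p) = ∷-cong (K.*-identityˡ x) (scale-1 p)

  shift-+ₚ : ∀ p q → 0# ∷ (p +ₚ q) ≋ (0# ∷ p) +ₚ (0# ∷ q)
  shift-+ₚ p q = ∷-cong (≡.sym (K.+-identityˡ 0#)) ≋-refl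

  *ₚ-congˡ : ∀ p {q r} → q ≋ r → p *ₚ q ≋ p *ₚ r
  *ₚ-congˡ []      e = ≋-refl
  *ₚ-congˡ (x ∷ p) e = +ₚ-cong (scale-cong ≡.refl e) (∷-cong ≡.refl (*ₚ-congˡ p e))

  *ₚ-distribˡ : ∀ p q r → p *ₚ (q +ₚ r) ≋ (p *ₚ q) +ₚ (p *ₚ r)
  *ₚ-distribˡ []      q r = ≋-refl
  *ₚ-distribˡ (x ∷ p) q r = begin
    scale x (q +ₚ r) +ₚ (0# ∷ p *ₚ (q +ₚ r))
      ≈⟨ +ₚ-cong (scale-+ₚ x q r) (≋-trans (∷-cong ≡.refl (*ₚ-distribˡ p q r)) (shift-+ₚ (p *ₚ q) (p *ₚ r))) ⟩
    (scale x q +ₚ scale x r) +ₚ ((0# ∷ p *ₚ q) +ₚ (0# ∷ p *ₚ r))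
      ≈⟨ interchange (scale x q) (scale x r) (0# ∷ p *ₚ q) (0# ∷ p *ₚ r) ⟩
    ((x ∷ p) *ₚ q) +ₚ ((x ∷ p) *ₚ r) ∎

  *ₚ-zeroʳ : ∀ p → p *ₚ [] ≋ []
  *ₚ-zeroʳ []      = ≋-refl
  *ₚ-zeroʳ (x ∷ p) = ∷-zero ≡.refl (*ₚ-zeroʳ p)

  -- The defining equation of the product, mirrored to the second factor. Commutativity follows from
  -- it by induction, and right distributivity from commutativity.
  *ₚ-∷ : ∀ p y q → p *ₚ (y ∷ q) ≋ scale y p +ₚ (0# ∷ p *ₚ q)
  *ₚ-∷ []      y q = ≋-sym (∷-zero ≡.refl ≋-refl)
  *ₚ-∷ (x ∷ p) y q = ∷-cong (≡.cong (K._+ 0#) (K.*-comm x y)) (begin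
    scale x q +ₚ (p *ₚ (y ∷ q))                 ≈⟨ +ₚ-cong ≋-refl (*ₚ-∷ p y q) ⟩
    scale x q +ₚ (scale y p +ₚ (0# ∷ p *ₚ q))   ≈⟨ x∙yz≈y∙xz (scale x q) (scale y p) (0# ∷ p *ₚ q) ⟩
    scale y p +ₚ (scale x q +ₚ (0# ∷ p *ₚ q))   ∎)

  *ₚ-comm : ∀ p q → p *ₚ q ≋ q *ₚ p
  *ₚ-comm []      q = ≋-sym (*ₚ-zeroʳ q)
  *ₚ-comm (x ∷ p) q = ≋-trans (+ₚ-cong ≋-refl (∷-cong ≡.refl (*ₚ-comm p q))) (≋-sym (*ₚ-∷ q x p))

  *ₚ-cong : ∀ {p q r s} → p ≋ q → r ≋ s → p *ₚ r ≋ q *ₚ s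
  *ₚ-cong {p} {q} {r} {s} e f = begin
    p *ₚ r ≈⟨ *ₚ-congˡ p f ⟩
    p *ₚ s ≈⟨ *ₚ-comm p s ⟩
    s *ₚ p ≈⟨ *ₚ-congˡ s e ⟩
    s *ₚ q ≈⟨ *ₚ-comm s q ⟩
    q *ₚ s ∎

  *ₚ-distribʳ : ∀ p q r → (q +ₚ r) *ₚ p ≋ (q *ₚ p) +ₚ (r *ₚ p)
  *ₚ-distribʳ p q r = begin
    (q +ₚ r) *ₚ p          ≈⟨ *ₚ-comm (q +ₚ r) p ⟩
    p *ₚ (q +ₚ r)          ≈⟨ *ₚ-distribˡ p q r ⟩
    (p *ₚ q) +ₚ (p *ₚ r)   ≈⟨ +ₚ-cong (*ₚ-comm p q) (*ₚ-comm p r) ⟩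
    (q *ₚ p) +ₚ (r *ₚ p)   ∎

  scale-*ₚ : ∀ c p q → scale c p *ₚ q ≋ scale c (p *ₚ q)
  scale-*ₚ c []      q = ≋-refl
  scale-*ₚ c (x ∷ p) q = begin
    scale (c K.* x) q +ₚ (0# ∷ scale c p *ₚ q)
      ≈⟨ +ₚ-cong (scale-* c x q) (∷-cong (≡.sym (K.zeroʳ c)) (scale-*ₚ c p q)) ⟩
    scale c (scale x q) +ₚ scale c (0# ∷ p *ₚ q)
      ≈⟨ scale-+ₚ c _ (0# ∷ p *ₚ q) ⟨
    scale c ((x ∷ p) *ₚ q) ∎

  shift-*ₚ : ∀ p q → (0# ∷ p) *ₚ q ≋ 0# ∷ p *ₚ q
  shift-*ₚ p q = +ₚ-cong (scale-0 q) ≋-refl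

  *ₚ-assoc : ∀ p q r → (p *ₚ q) *ₚ r ≋ p *ₚ (q *ₚ r)
  *ₚ-assoc []      q r = ≋-refl
  *ₚ-assoc (x ∷ p) q r = begin
    (scale x q +ₚ (0# ∷ p *ₚ q)) *ₚ r             ≈⟨ *ₚ-distribʳ r (scale x q) (0# ∷ p *ₚ q) ⟩
    (scale x q *ₚ r) +ₚ ((0# ∷ p *ₚ q) *ₚ r)      ≈⟨ +ₚ-cong (scale-*ₚ x q r) (shift-*ₚ (p *ₚ q) r) ⟩
    scale x (q *ₚ r) +ₚ (0# ∷ (p *ₚ q) *ₚ r)      ≈⟨ +ₚ-cong ≋-refl (∷-cong ≡.refl (*ₚ-assoc p q r)) ⟩
    (x ∷ p) *ₚ (q *ₚ r)                           ∎

  const-*ₚ : ∀ c p → [ c ] *ₚ p ≋ scale c p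
  const-*ₚ c p = ≋-trans (+ₚ-cong {r = 0# ∷ []} ≋-refl (∷-zero ≡.refl ≋-refl)) (+ₚ-identityʳ _)

  *ₚ-identityˡ : ∀ p → 1ₚ *ₚ p ≋ p
  *ₚ-identityˡ p = ≋-trans (const-*ₚ 1# p) (scale-1 p)

  opaque
    -- Only the proofs of the laws are hidden; the operations occur in the type, so those of `A`
    -- still compute.
    isCommutativeRingₚ : IsCommutativeRing _≋_ _+ₚ_ _*ₚ_ -ₚ_ 0ₚ 1ₚ
    isCommutativeRingₚ = record
      { isRing = record
        { +-isAbelianGroup = +ₚ-isAbelianGroup
        ; *-cong           = *ₚ-cong
        ; *-assoc          = *ₚ-assoc
        ; *-identity       = *ₚ-identityˡ , λ p → ≋-trans (*ₚ-comm p 1ₚ) (*ₚ-identityˡ p)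
        ; distrib          = *ₚ-distribˡ , *ₚ-distribʳ
        }
      ; *-comm = *ₚ-comm
      }

  A : CommutativeRing 0ℓ 0ℓ
  A = record { isCommutativeRing = isCommutativeRingₚ }

-- Degrees, division with remainder and Bézout's identity

module Division (F : FiniteField) where

  open Polynomials F
  open Congruence A

  open FiniteField F using (Carrier; inverse; 0≢1; _≟_)
  open Poly F using (Poly; normalize; deg; 0ₚ; 1ₚ; _+ₚ_; _*ₚ_)
  private
    module K = CommutativeRing K
    module A = CommutativeRing A
    module KI = Integers K
    module AI = Integers A
  open K using (0#; 1#)

  infixl 6 _-ₚ_
  _-ₚ_ : Poly → Poly → Poly
  p -ₚ q = p +ₚ (-ₚ q)

  -- Degree n expressed without `normalize`, up to trailing zeros: n lower coefficients below a
  -- nonzero one. Degrees can then be compared by looking at single coefficients.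
  data Leading (p : Poly) (n : ℕ) : Set where
    leading : ∀ (v : Vec Carrier n) c → ¬ c ≡ 0# → p ≋ toList v ++ [ c ] → Leading p n

  coeff-toList : ∀ {n} (v : Vec Carrier n) {i} → n ≤ i → coeff (toList v) i ≡ 0#
  coeff-toList []      _         = ≡.refl
  coeff-toList (x ∷ v) (s≤s n≤i) = coeff-toList v n≤i

  toList-injective : ∀ {n} (v w : Vec Carrier n) → toList v ≋ toList w → v ≡ w
  toList-injective []      []      e = ≡.refl
  toList-injective (x ∷ v) (y ∷ w) e = ≡.cong₂ _∷_ (e .at 0) (toList-injective v w (≋-tail e))

  coeff-snoc : ∀ {n} (v : Vec Carrier n) c → coeff (toList v ++ [ c ]) n ≡ c
  coeff-snoc []      c = ≡.refl
  coeff-snoc (x ∷ v) c = coeff-snoc v c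

  coeff-snoc-above : ∀ {n} (v : Vec Carrier n) c {i} → n < i → coeff (toList v ++ [ c ]) i ≡ 0#
  coeff-snoc-above []      c (s≤s _)   = ≡.refl
  coeff-snoc-above (x ∷ v) c (s≤s n<i) = coeff-snoc-above v c n<i

  coeff-leading : ∀ {p n} → Leading p n → ¬ coeff p n ≡ 0#
  coeff-leading {n = n} (leading v c c≢0 p≋) e = c≢0 (≡.trans (≡.sym (coeff-snoc v c)) (≡.trans (≡.sym (p≋ .at n)) e))

  coeff-above : ∀ {p n i} → Leading p n → n < i → coeff p i ≡ 0#
  coeff-above {i = i} (leading v c _ p≋) n<i = ≡.trans (p≋ .at i) (coeff-snoc-above v c n<i)

  leading-unique : ∀ {p m n} → Leading p m → Leading p n → m ≡ n
  leading-unique {m = m} {n} l l′ with ℕ.<-cmp m n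
  ... | tri< m<n _ _ = ⊥-elim (coeff-leading l′ (coeff-above l m<n))
  ... | tri≈ _ m≡n _ = m≡n
  ... | tri> _ _ n<m = ⊥-elim (coeff-leading l (coeff-above l′ n<m))

  leading-≋ : ∀ {p q n} → p ≋ q → Leading p n → Leading q n
  leading-≋ e (leading v c c≢0 f) = leading v c c≢0 (≋-trans (≋-sym e) f)

  normalize-≋ : ∀ p → normalize p ≋ p
  normalize-≋ [] = ≋-refl
  normalize-≋ (x ∷ p) with normalize p | normalize-≋ p
  ... | y ∷ q | e = ∷-cong ≡.refl e
  ... | []    | e with x ≟ 0#
  ...   | yes x≡0 = ≋-sym (∷-zero x≡0 (≋-sym e))
  ...   | no  _   = ∷-cong ≡.refl e

  data Normal : Poly → Set where
    zero    : Normal []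
    nonzero : ∀ {n} (v : Vec Carrier n) c → ¬ c ≡ 0# → Normal (toList v ++ [ c ])

  normalize-normal : ∀ p → Normal (normalize p)
  normalize-normal [] = zero
  normalize-normal (x ∷ p) with normalize p | normalize-normal p
  ... | y ∷ q | n = extend n ≡.refl
    where
    -- The index `toList v ++ [ c ]` does not unify with `y ∷ q`, so the list is generalised to r
    -- with an equation.
    extend : ∀ {r} → Normal r → r ≡ y ∷ q → Normal (x ∷ y ∷ q)
    extend (nonzero v c c≢0) e = ≡.subst (λ r → Normal (x ∷ r)) e (nonzero (x ∷ v) c c≢0)
  ... | []    | _ with x ≟ 0#
  ...   | yes _   = zero
  ...   | no  x≢0 = nonzero [] x x≢0

  length-snoc : ∀ {n} (v : Vec Carrier n) c → length (toList v ++ [ c ]) ≡ suc n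
  length-snoc []      c = ≡.refl
  length-snoc (x ∷ v) c = ≡.cong suc (length-snoc v c)

  zero-or-leading : ∀ p → p ≋ [] ⊎ Leading p (deg p)
  zero-or-leading p with normalize p | normalize-≋ p | normalize-normal p
  ... | _ | e | zero            = inj₁ (≋-sym e)
  ... | _ | e | nonzero v c c≢0 = inj₂ (≡.subst (Leading p) (≡.cong (ℕ._∸ 1) (≡.sym (length-snoc v c))) (leading v c c≢0 (≋-sym e)))

  leading-deg : ∀ {p} → ¬ p ≋ [] → Leading p (deg p)
  leading-deg {p} p≉0 with zero-or-leading p
  ... | inj₁ p≋0 = ⊥-elim (p≉0 p≋0)
  ... | inj₂ l   = l

  leading-nonzero : ∀ {p n} → Leading p n → ¬ p ≋ []
  leading-nonzero {n = n} l e = coeff-leading l (e .at n)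

  deg-unique : ∀ {p n} → Leading p n → deg p ≡ n
  deg-unique l = leading-unique (leading-deg (leading-nonzero l)) l

  1≢0 : ¬ 1# ≡ 0#
  1≢0 = 0≢1 ∘ ≡.sym

  K-integral : ∀ {c d} → ¬ c ≡ 0# → ¬ d ≡ 0# → ¬ c K.* d ≡ 0#
  K-integral {c} {d} c≢0 d≢0 cd≡0 with inverse c c≢0
  ... | c⁻¹ , cc⁻¹≡1 = d≢0 (begin
    d                     ≡⟨ K.*-identityˡ d ⟨
    1# K.* d              ≡⟨ ≡.cong (K._* d) cc⁻¹≡1 ⟨
    c K.* c⁻¹ K.* d       ≡⟨ KI.solve 3 (λ c i d → c KI.:* i KI.:* d KI.:= i KI.:* (c KI.:* d)) ≡.refl c c⁻¹ d ⟩
    c⁻¹ K.* (c K.* d)     ≡⟨ ≡.cong (c⁻¹ K.*_) cd≡0 ⟩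
    c⁻¹ K.* 0#            ≡⟨ K.zeroʳ c⁻¹ ⟩
    0#                    ∎)
    where open ≡.≡-Reasoning

  +ₚ-snoc : ∀ {n} p (v : Vec Carrier n) c → length p ≤ n → ∃[ w ] p +ₚ (toList v ++ [ c ]) ≡ toList {n = n} w ++ [ c ]
  +ₚ-snoc []      v       c _         = v , ≡.refl
  +ₚ-snoc (x ∷ p) (y ∷ v) c (s≤s p≤n) with +ₚ-snoc p v c p≤n
  ... | w , e = x K.+ y ∷ w , ≡.cong (x K.+ y ∷_) e

  -- In the recursive step the summand coming from x has only n + 1 coefficients, too few to reach
  -- the top position, so the leading coefficient `c * d` is passed on unchanged.
  snoc-*ₚ-snoc : ∀ {m n} (v : Vec Carrier m) c (w : Vec Carrier n) d →
                 ∃[ u ] (toList v ++ [ c ]) *ₚ (toList w ++ [ d ]) ≋ toList {n = m ℕ.+ n} u ++ [ c K.* d ]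
  snoc-*ₚ-snoc []      c w d = Vec.map (c K.*_) w , ≋-trans (const-*ₚ c _) (pointwise λ n → ≡.cong (λ l → coeff l n) (map-snoc w))
    where
    map-snoc : ∀ {n} (w : Vec Carrier n) → scale c (toList w ++ [ d ]) ≡ toList (Vec.map (c K.*_) w) ++ [ c K.* d ]
    map-snoc []      = ≡.refl
    map-snoc (x ∷ w) = ≡.cong (_ ∷_) (map-snoc w)
  snoc-*ₚ-snoc {suc m} {n} (x ∷ v) c w d with snoc-*ₚ-snoc v c w d
  ... | u , e with +ₚ-snoc (scale x (toList w ++ [ d ])) (0# ∷ u) (c K.* d) short
    where
    short : length (scale x (toList w ++ [ d ])) ≤ suc m ℕ.+ n
    short = ℕ.≤-trans (ℕ.≤-reflexive (≡.trans (length-map (x K.*_) (toList w ++ [ d ])) (length-snoc w d))) (s≤s (ℕ.m≤n+m n m))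
  ... | u′ , e′ = u′ , ≋-trans (+ₚ-cong {scale x (toList w ++ [ d ])} ≋-refl (∷-cong ≡.refl e)) (A.reflexive e′)

  leading-* : ∀ {p q m n} → Leading p m → Leading q n → Leading (p *ₚ q) (m ℕ.+ n)
  leading-* (leading v c c≢0 e) (leading w d d≢0 f) with snoc-*ₚ-snoc v c w d
  ... | u , g = leading u (c K.* d) (K-integral c≢0 d≢0) (≋-trans (*ₚ-cong e f) g)

  leading-1 : Leading 1ₚ 0
  leading-1 = leading [] 1# 1≢0 ≋-refl

  ≋0? : ∀ p → Dec (p ≋ [])
  ≋0? p with zero-or-leading p
  ... | inj₁ e = yes e
  ... | inj₂ l = no (leading-nonzero l)

  *ₚ-nonzero : ∀ {p q} → ¬ p ≋ [] → ¬ q ≋ [] → ¬ p *ₚ q ≋ []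
  *ₚ-nonzero p≉0 q≉0 = leading-nonzero (leading-* (leading-deg p≉0) (leading-deg q≉0))

  deg-* : ∀ {p q} → ¬ p ≋ [] → ¬ q ≋ [] → deg (p *ₚ q) ≡ deg p ℕ.+ deg q
  deg-* p≉0 q≉0 = deg-unique (leading-* (leading-deg p≉0) (leading-deg q≉0))

  deg-cong : ∀ {p q} → ¬ p ≋ [] → p ≋ q → deg p ≡ deg q
  deg-cong p≉0 e = ≡.sym (deg-unique (leading-≋ e (leading-deg p≉0)))

  *ₚ-cancelʳ : ∀ {d} → ¬ d ≋ [] → ∀ p q → p *ₚ d ≋ q *ₚ d → p ≋ q
  *ₚ-cancelʳ {d} d≉0 p q e with ≋0? (p -ₚ q)
  ... | yes p-q≋0 = x∙y⁻¹≈ε⇒x≈y p q p-q≋0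
    where open import Algebra.Properties.Group A.+-group
  ... | no  p-q≉0 = ⊥-elim (*ₚ-nonzero p-q≉0 d≉0 (A.trans ([y-z]x≈yx-zx d p q) (x≈y⇒x∙y⁻¹≈ε e)))
    where
    open import Algebra.Properties.Group A.+-group
    open import Algebra.Properties.Ring A.ring using ([y-z]x≈yx-zx)

  ∣-nonzero : ∀ {p q} → p ∣ q → ¬ q ≋ [] → ¬ p ≋ []
  ∣-nonzero {p} (u , e) q≉0 p≋0 = q≉0 (A.trans (A.sym e) (A.trans (A.*-congˡ {u} p≋0) (A.zeroʳ u)))

  -- Eliminating the coefficient c of T^n by subtracting d h, where h has leading coefficient l and c = d l.
  eliminate : ∀ {n} (v w : Vec Carrier n) {c d l} → d K.* l ≡ c →
              scale d (toList w ++ [ l ]) ≋ (toList v ++ [ c ]) -ₚ toList (Vec.zipWith (λ x y → x K.- d K.* y) v w)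
  eliminate []      []      dl≡c = ∷-cong dl≡c ≋-refl
  eliminate (x ∷ v) (y ∷ w) {d = d} dl≡c = ∷-cong
    (KI.solve 2 (λ x dy → dy KI.:= x KI.:- (x KI.:- dy)) ≡.refl x (d K.* y)) (eliminate v w dl≡c)

  unsnoc : ∀ {n} (v : Vec Carrier (suc n)) → ∃[ w ] ∃[ c ] toList v ≡ toList {n = n} w ++ [ c ]
  unsnoc (x ∷ [])    = [] , x , ≡.refl
  unsnoc (x ∷ y ∷ v) with unsnoc (y ∷ v)
  ... | w , c , e = x ∷ w , c , ≡.cong (x ∷_) e

  toList-zeros : ∀ n → toList (Vec.replicate n 0#) ≋ []
  toList-zeros zero    = ≋-refl
  toList-zeros (suc n) = ∷-zero ≡.refl (toList-zeros n)

  coeff-sub : ∀ p q n → coeff (p -ₚ q) n ≡ coeff p n K.- coeff q n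
  coeff-sub p q n = ≡.trans (coeff-+ p (-ₚ q) n) (≡.cong (coeff p n K.+_) (coeff-neg q n))

  ∷-≡ : ∀ {h p q} x → p ≡ q ⟦ h ⟧ → x ∷ p ≡ x ∷ q ⟦ h ⟧
  ∷-≡ {h} {p} {q} x (congruent (u , e)) = congruent (0# ∷ u ,
    ≋-trans (shift-*ₚ u h) (∷-cong (≡.sym (K.-‿inverseʳ x)) e))

  reduce : ∀ {h n} → Leading h n → (v : Vec Carrier (suc n)) → ∃[ w ] toList v ≡ toList {n = n} w ⟦ h ⟧
  reduce {h} {n} (leading t l l≢0 h≋) v with unsnoc v
  ... | w , c , v≡wc with inverse l l≢0
  ...   | l⁻¹ , ll⁻¹≡1 = r , congruent ([ d ] , (begin
    [ d ] *ₚ h              ≈⟨ const-*ₚ d h ⟩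
    scale d h               ≈⟨ scale-cong ≡.refl h≋ ⟩
    scale d (toList t ++ [ l ]) ≈⟨ eliminate w t dl≡c ⟩
    (toList w ++ [ c ]) -ₚ toList r  ≡⟨ ≡.cong (_-ₚ toList r) v≡wc ⟨
    toList v -ₚ toList r           ∎))
    where
    open import Relation.Binary.Reasoning.Setoid A.setoid
    d : Carrier
    d = c K.* l⁻¹
    r : Vec Carrier n
    r = Vec.zipWith (λ x y → x K.- d K.* y) w t
    dl≡c : d K.* l ≡ c
    dl≡c = ≡.trans (K.*-assoc c l⁻¹ l) (≡.trans (≡.cong (c K.*_) (≡.trans (K.*-comm l⁻¹ l) ll⁻¹≡1)) (K.*-identityʳ c))

  module Remainder {h n} (L : Leading h n) where

    private
      -- A nonzero u would give `u *ₚ h` a nonzero coefficient in position deg u + n, but both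
      -- vectors end before position n.
      low-degree-multiple : ∀ {v w : Vec Carrier n} u → u *ₚ h ≋ toList v -ₚ toList w → u ≋ []
      low-degree-multiple {v} {w} u e with zero-or-leading u
      ... | inj₁ u≋0 = u≋0
      ... | inj₂ l   = ⊥-elim (coeff-leading (leading-* l L) (begin
        coeff (u *ₚ h) top                              ≡⟨ e .at top ⟩
        coeff (toList v -ₚ toList w) top                ≡⟨ coeff-sub (toList v) (toList w) top ⟩
        coeff (toList v) top K.- coeff (toList w) top   ≡⟨ ≡.cong₂ K._-_ (coeff-toList v n≤top) (coeff-toList w n≤top) ⟩
        0# K.- 0#                                       ≡⟨ K.-‿inverseʳ 0# ⟩
        0#                                              ∎))
        where
        open ≡.≡-Reasoning
        top : ℕ
        top = deg u ℕ.+ n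
        n≤top : n ≤ top
        n≤top = ℕ.m≤n+m n (deg u)

    residue-unique : ∀ {v w : Vec Carrier n} → toList v ≡ toList w ⟦ h ⟧ → v ≡ w
    residue-unique {v} {w} (congruent (u , e)) = toList-injective v w (x∙y⁻¹≈ε⇒x≈y _ _
      (A.trans (A.sym e) (A.trans (A.*-congʳ {h} (low-degree-multiple {v} {w} u e)) (A.zeroˡ h))))
      where open import Algebra.Properties.Group A.+-group using (x∙y⁻¹≈ε⇒x≈y)

    -- Horner's scheme: x ∷ p is x + T p, so a remainder of p yields n + 1 coefficients congruent to
    -- it, and one elimination brings them back to n.
    divide : ∀ p → ∃[ w ] p ≡ toList {n = n} w ⟦ h ⟧
    divide []      = Vec.replicate n 0# , ≈⇒≡ (≋-sym (toList-zeros n))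
    divide (x ∷ p) with divide p
    ... | w , p≡w with reduce L (x ∷ w)
    ...   | w′ , xw≡w′ = w′ , ≡-trans (∷-≡ x p≡w) xw≡w′

    rem : Poly → Vec Carrier n
    rem p = proj₁ (divide p)

    rem-≡ : ∀ p → p ≡ toList (rem p) ⟦ h ⟧
    rem-≡ p = proj₂ (divide p)

    rem-cong : ∀ {p q} → p ≡ q ⟦ h ⟧ → rem p ≡ rem q
    rem-cong {p} {q} e = residue-unique (≡-trans (≡-sym (rem-≡ p)) (≡-trans e (rem-≡ q)))

    residues : Mod h ≅ ≡.setoid (Vec Carrier n)
    residues = record
      { to        = rem
      ; from      = toList
      ; to-cong   = rem-cong
      ; from-cong = λ { ≡.refl → ≈⇒≡ ≋-refl }
      ; inverse   = (λ {v} {p} e → residue-unique (≡-trans (≡-sym (rem-≡ p)) e))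
                  , (λ { {p} ≡.refl → ≡-sym (rem-≡ p) })
      }

    multiple? : ∀ p → Dec (h ∣ p)
    multiple? p = Dec.map′
      (λ e → ≡0⇒∣ (≡-trans (rem-≡ p) (≡-trans (≈⇒≡ (A.reflexive (≡.cong toList e))) (≡-sym (rem-≡ [])))))
      (rem-cong ∘ ∣⇒≡0)
      (≡-dec _≟_ (rem p) (rem []))

  Bezout : Poly → Poly → Set
  Bezout p q = ∃[ g ] g ∣ p × g ∣ q × ∃[ u ] ∃[ v ] (u *ₚ p) +ₚ (v *ₚ q) ≋ g

  -- Euclid's algorithm. Keeping the second argument as a vector makes its length the decreasing
  -- measure: the remainder has deg v entries, and deg v < n because v has no coefficient from
  -- position n on.
  bezout-vec : ∀ {n} → Acc _<_ n → ∀ p (v : Vec Carrier n) → Bezout p (toList v)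
  bezout-vec (acc rs) p v with zero-or-leading (toList v)
  ... | inj₁ v≋0 = p , (1ₚ , A.*-identityˡ p) , ∣-respʳ (A.sym v≋0) (0ₚ , ≋-refl)
                 , 1ₚ , 0ₚ , A.trans (A.+-identityʳ _) (A.*-identityˡ p)
  ... | inj₂ l with Remainder.divide l p
  ...   | r , congruent (s , sv≋p-r) with bezout-vec (rs (ℕ.≰⇒> λ n≤deg → coeff-leading l (coeff-toList v n≤deg))) (toList v) r
  ...     | g , g∣v , g∣r , u , w , e = g
    , ∣-respʳ (AI.solve 2 (λ p r → r AI.:+ (p AI.:- r) AI.:= p) A.refl p (toList r))
              (∣-+ g∣r (∣-respʳ sv≋p-r (∣-*ˡ s g∣v)))
    -- With r = p - s v, the combination u v + w r becomes w p + (u - w s) v.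
    , g∣v , w , u -ₚ (w *ₚ s) , (begin
      (w *ₚ p) +ₚ ((u -ₚ (w *ₚ s)) *ₚ toList v)
        ≈⟨ AI.solve 5 (λ w p u s v → w AI.:* p AI.:+ (u AI.:- w AI.:* s) AI.:* v
                                AI.:= u AI.:* v AI.:+ w AI.:* (p AI.:- s AI.:* v)) A.refl w p u s (toList v) ⟩
      (u *ₚ toList v) +ₚ (w *ₚ (p -ₚ (s *ₚ toList v)))
        ≈⟨ A.+-congˡ {u *ₚ toList v} (A.*-congˡ {w} (A.+-congˡ {p} (A.-‿cong sv≋p-r))) ⟩
      (u *ₚ toList v) +ₚ (w *ₚ (p -ₚ (p -ₚ toList r)))
        ≈⟨ A.+-congˡ {u *ₚ toList v} (A.*-congˡ {w}
             (AI.solve 2 (λ p r → p AI.:- (p AI.:- r) AI.:= r) A.refl p (toList r))) ⟩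
      (u *ₚ toList v) +ₚ (w *ₚ toList r)
        ≈⟨ e ⟩
      g ∎)
    where open import Relation.Binary.Reasoning.Setoid A.setoid

  bezout : ∀ p q → Bezout p q
  bezout p q = ≡.subst (Bezout p) (toList∘fromList q) (bezout-vec (<-wellFounded _) p (fromList q))

-- Units, irreducible polynomials and their divisibility

module Counting (F : FiniteField) where

  open Polynomials F
  open Division F
  open Congruence A

  open FiniteField F using (Carrier; inverse; elements; elements-unique; elements-complete; 0≢1; q)
  open Poly F hiding (_≈ₚ_)
  open Formula F
  private
    module K = CommutativeRing K
    module A = CommutativeRing A
  open K using (0#; 1#)

  ∣⇒∣ₚ : ∀ {p q} → p ∣ q → p ∣ₚ q
  ∣⇒∣ₚ (u , e) = u , ≋⇒≈ₚ e

  ∣ₚ⇒∣ : ∀ {p q} → p ∣ₚ q → p ∣ q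
  ∣ₚ⇒∣ (u , e) = u , ≈ₚ⇒≋ e

  1ₚ≉0 : ¬ 1ₚ ≋ []
  1ₚ≉0 = leading-nonzero leading-1

  ∣-unit : ∀ {p u} → p ∣ u → Unit u → Unit p
  ∣-unit p∣u u-unit = ∣⇒∣ₚ (∣-trans p∣u (∣ₚ⇒∣ u-unit))

  unit⇒deg≡0 : ∀ {u} → Unit u → deg u ≡ 0
  unit⇒deg≡0 {u} u-unit with ∣ₚ⇒∣ u-unit
  ... | v , vu≋1 = ℕ.m+n≡0⇒n≡0 (deg v) (begin
    deg v ℕ.+ deg u   ≡⟨ deg-* v≉0 u≉0 ⟨
    deg (v *ₚ u)      ≡⟨ deg-unique (leading-≋ (A.sym vu≋1) leading-1) ⟩
    0                 ∎)
    where
    open ≡.≡-Reasoning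
    u≉0 : ¬ u ≋ []
    u≉0 = ∣-nonzero (v , vu≋1) 1ₚ≉0
    v≉0 : ¬ v ≋ []
    v≉0 = ∣-nonzero (u , A.trans (A.*-comm u v) vu≋1) 1ₚ≉0

  deg≡0⇒const : ∀ {u} → ¬ u ≋ [] → deg u ≡ 0 → ∃[ c ] ¬ c ≡ 0# × u ≋ [ c ]
  deg≡0⇒const {u} u≉0 deg≡0 with ≡.subst (Leading u) deg≡0 (leading-deg u≉0)
  ... | leading [] c c≢0 e = c , c≢0 , e

  scale-associate : ∀ {c} → ¬ c ≡ 0# → ∃[ d ] (∀ p → scale d (scale c p) ≋ p) × d K.* c ≡ 1#
  scale-associate {c} c≢0 with inverse c c≢0
  ... | d , cd≡1 = d , (λ p → ≋-trans (≋-sym (scale-* d c p)) (≋-trans (scale-cong dc≡1 ≋-refl) (scale-1 p))) , dc≡1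
    where
    dc≡1 : d K.* c ≡ 1#
    dc≡1 = ≡.trans (K.*-comm d c) cd≡1

  scale-∣ : ∀ c p → p ∣ scale c p
  scale-∣ c p = [ c ] , const-*ₚ c p

  deg≡0⇒unit : ∀ {u} → ¬ u ≋ [] → deg u ≡ 0 → Unit u
  deg≡0⇒unit u≉0 deg≡0 with deg≡0⇒const u≉0 deg≡0
  ... | c , c≢0 , e with scale-associate c≢0
  ...   | d , _ , dc≡1 = ∣⇒∣ₚ ([ d ] , ≋-trans (*ₚ-cong {[ d ]} ≋-refl e) (≋-trans (const-*ₚ d [ c ]) (∷-cong dc≡1 ≋-refl)))

  unit? : ∀ {u} → ¬ u ≋ [] → Dec (Unit u)
  unit? {u} u≉0 = Dec.map′ (deg≡0⇒unit u≉0) unit⇒deg≡0 (deg u ℕ.≟ 0)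

  irreducible-nonzero : ∀ {p} → Irreducible p → ¬ p ≋ []
  irreducible-nonzero (p≉0 , _) e = p≉0 (≋⇒≈ₚ e)

  module _ {p : Poly} (irr : Irreducible p) where

    private
      split : ∀ a b → a *ₚ b ≋ p → Unit a ⊎ Unit b
      split a b e = proj₂ (proj₂ irr) a b (≋⇒≈ₚ e)

    irreducible-nonunit : ¬ Unit p
    irreducible-nonunit = proj₁ (proj₂ irr)

    -- Let g be the common divisor from Bézout, with p = e g. If e is a unit, then p divides g and
    -- hence a, which is excluded. So g is a unit, and its inverse scales the Bézout identity to 1.
    irreducible-comaximal : ∀ {a} → ¬ p ∣ a → Comaximal p a
    irreducible-comaximal {a} p∤a with bezout p a
    ... | g , (e , eg≋p) , g∣a , u , v , up+va≋g with split e g eg≋p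
    ...   | inj₁ e-unit = ⊥-elim (p∤a (∣-trans (p∣g (∣ₚ⇒∣ e-unit)) g∣a))
      where
      open import Relation.Binary.Reasoning.Setoid A.setoid
      p∣g : e ∣ 1ₚ → p ∣ g
      p∣g (f , fe≋1) = f , (begin
        f *ₚ p           ≈⟨ A.*-congˡ {f} eg≋p ⟨
        f *ₚ (e *ₚ g)    ≈⟨ A.*-assoc f e g ⟨
        (f *ₚ e) *ₚ g    ≈⟨ A.*-congʳ {g} fe≋1 ⟩
        1ₚ *ₚ g          ≈⟨ A.*-identityˡ g ⟩
        g                ∎)
    ...   | inj₂ g-unit with ∣ₚ⇒∣ g-unit
    ...     | f , fg≋1 = f *ₚ u , f *ₚ v , (begin
      ((f *ₚ u) *ₚ p) +ₚ ((f *ₚ v) *ₚ a)   ≈⟨ A.+-cong (A.*-assoc f u p) (A.*-assoc f v a) ⟩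
      (f *ₚ (u *ₚ p)) +ₚ (f *ₚ (v *ₚ a))   ≈⟨ A.distribˡ f (u *ₚ p) (v *ₚ a) ⟨
      f *ₚ ((u *ₚ p) +ₚ (v *ₚ a))          ≈⟨ A.*-congˡ {f} up+va≋g ⟩
      f *ₚ g                               ≈⟨ fg≋1 ⟩
      1ₚ                                   ∎)
      where open import Relation.Binary.Reasoning.Setoid A.setoid

    irreducible-prime : ∀ {a b} → ¬ p ∣ a → p ∣ a *ₚ b → p ∣ b
    irreducible-prime {a} {b} p∤a p∣ab with irreducible-comaximal p∤a
    ... | u , v , e = ∣-respʳ eq (∣-+ (∣-*ʳ b (∣-*ˡ u (1ₚ , A.*-identityˡ p))) (∣-*ˡ v p∣ab))
      where
      open import Relation.Binary.Reasoning.Setoid A.setoid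
      eq : ((u *ₚ p) *ₚ b) +ₚ (v *ₚ (a *ₚ b)) ≋ b
      eq = begin
        ((u *ₚ p) *ₚ b) +ₚ (v *ₚ (a *ₚ b))   ≈⟨ A.+-congˡ {(u *ₚ p) *ₚ b} (A.*-assoc v a b) ⟨
        ((u *ₚ p) *ₚ b) +ₚ ((v *ₚ a) *ₚ b)   ≈⟨ A.distribʳ b (u *ₚ p) (v *ₚ a) ⟨
        ((u *ₚ p) +ₚ (v *ₚ a)) *ₚ b          ≈⟨ A.*-congʳ {b} e ⟩
        1ₚ *ₚ b                              ≈⟨ A.*-identityˡ b ⟩
        b                                    ∎

    irreducible-∤1 : ¬ p ∣ 1ₚ
    irreducible-∤1 p∣1 = irreducible-nonunit (∣⇒∣ₚ p∣1)

    irreducible-∤prod : ∀ {qs} → All (λ q → ¬ p ∣ q) qs → ¬ p ∣ prodₚ qs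
    irreducible-∤prod []           p∣1 = irreducible-∤1 p∣1
    irreducible-∤prod (p∤q ∷ p∤qs) p∣  = irreducible-∤prod p∤qs (irreducible-prime p∤q p∣)

    -- With p = w r, a factorisation r = a b gives p = (w a) b; if w a is a unit, so is its divisor
    -- a.
    irreducible-associate : ∀ {r} → p ∣ r → r ∣ p → Irreducible r
    irreducible-associate {r} p∣r (w , wr≋p) =
        (λ r≈0 → ∣-nonzero (w , wr≋p) (irreducible-nonzero irr) (≈ₚ⇒≋ r≈0))
      , (λ r-unit → irreducible-nonunit (∣-unit p∣r r-unit))
      , split′
      where
      split′ : ∀ a b → _ → Unit a ⊎ Unit b
      split′ a b ab≈r with split (w *ₚ a) b (A.trans (A.*-assoc w a b) (A.trans (A.*-congˡ {w} {a *ₚ b} {r} (≈ₚ⇒≋ ab≈r)) wr≋p))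
      ... | inj₁ wa-unit = inj₁ (∣-unit (w , A.refl) wa-unit)
      ... | inj₂ b-unit  = inj₂ b-unit

  monic-associate : ∀ {p} → ¬ p ≋ [] → ∃[ m ] Monic m × m ∣ p × p ∣ m
  monic-associate {p} p≉0 with leading-deg p≉0
  ... | leading v c c≢0 e with scale-associate c≢0
  ...   | d , cancel , dc≡1 = scale d (toList v ++ [ c ])
    , (scale d (toList v) , ≡.trans (map-++ (d K.*_) (toList v) [ c ]) (≡.cong (λ x → scale d (toList v) ++ [ x ]) dc≡1))
    , ∣-respʳ (≋-trans (≋-sym (scale-* c d _)) (≋-trans (scale-cong (≡.trans (K.*-comm c d) dc≡1) ≋-refl) (≋-trans (scale-1 _) (≋-sym e))))
              (scale-∣ c (scale d (toList v ++ [ c ])))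
    , ∣-respʳ (scale-cong ≡.refl e) (scale-∣ d p)

  -- Double negation replaces the search for a proper factor of a reducible p.
  irreducible-divisor : ∀ {p} → Acc _<_ (deg p) → ¬ p ≋ [] → ¬ Unit p → ¬ (∀ r → Irreducible r → ¬ r ∣ p)
  irreducible-divisor {p} (acc rs) p≉0 p-nonunit none =
    -- Lacking irreducible divisors, p would itself be irreducible: in a product of two nonunits the
    -- factor a has smaller degree, and by induction it cannot lack one.
    none p ((λ p≈0 → p≉0 (≈ₚ⇒≋ p≈0)) , p-nonunit , split) (1ₚ , A.*-identityˡ p)
    where
    split : ∀ a b → _ → Unit a ⊎ Unit b
    split a b ab≈p = decide (unit? a≉0) (unit? b≉0)
      where
      ab≋p : a *ₚ b ≋ p
      ab≋p = ≈ₚ⇒≋ ab≈p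
      a∣p : a ∣ p
      a∣p = b , A.trans (A.*-comm b a) ab≋p
      a≉0 : ¬ a ≋ []
      a≉0 = ∣-nonzero a∣p p≉0
      b≉0 : ¬ b ≋ []
      b≉0 = ∣-nonzero (a , ab≋p) p≉0

      deg-a<deg-p : ¬ Unit b → deg a < deg p
      deg-a<deg-p b-nonunit = ℕ.≤-trans
        (ℕ.m<m+n (deg a) (ℕ.n≢0⇒n>0 (b-nonunit ∘ deg≡0⇒unit b≉0)))
        (ℕ.≤-reflexive (≡.trans (≡.sym (deg-* a≉0 b≉0)) (≡.sym (deg-cong p≉0 (A.sym ab≋p)))))

      decide : Dec (Unit a) → Dec (Unit b) → Unit a ⊎ Unit b
      decide (yes a-unit) _            = inj₁ a-unit
      decide _            (yes b-unit) = inj₂ b-unit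
      decide (no a-nonunit) (no b-nonunit) = ⊥-elim (irreducible-divisor (rs (deg-a<deg-p b-nonunit)) a≉0 a-nonunit
        (λ r r-irr r∣a → none r r-irr (∣-trans r∣a a∣p)))

  -- Lists ending in a nonzero entry have no trailing zeros. This upgrades equality of polynomials
  -- to the propositional equality that `Unique` speaks about.
  snoc-≋-injective : ∀ xs ys {c d} → ¬ c ≡ 0# → ¬ d ≡ 0# → xs ++ [ c ] ≋ ys ++ [ d ] → xs ++ [ c ] ≡ ys ++ [ d ]
  snoc-≋-injective []       []       _   _   e = ≡.cong [_] (e .at 0)
  snoc-≋-injective []       (y ∷ ys) c≢0 d≢0 e = ⊥-elim (snoc≉0 ys d≢0 (≋-sym (≋-tail e)))
    where
    snoc≉0 : ∀ zs {d} → ¬ d ≡ 0# → ¬ zs ++ [ d ] ≋ []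
    snoc≉0 []       d≢0 e = d≢0 (e .at 0)
    snoc≉0 (z ∷ zs) d≢0 e = snoc≉0 zs d≢0 (pointwise λ n → e .at (suc n))
  snoc-≋-injective (x ∷ xs) []       c≢0 d≢0 e = ≡.sym (snoc-≋-injective [] (x ∷ xs) d≢0 c≢0 (≋-sym e))
  snoc-≋-injective (x ∷ xs) (y ∷ ys) c≢0 d≢0 e = ≡.cong₂ _∷_ (e .at 0) (snoc-≋-injective xs ys c≢0 d≢0 (≋-tail e))

  -- In r = u p the factor u must be a unit, hence a constant c; comparing leading coefficients
  -- gives c = 1.
  monic-irreducible-∣ : ∀ {p r} → Monic p → Irreducible p → Monic r → Irreducible r → p ∣ r → p ≡ r
  monic-irreducible-∣ {p} (xs , ≡.refl) p-irr (ys , ≡.refl) r-irr (u , up≋r) with proj₂ (proj₂ r-irr) u p (≋⇒≈ₚ up≋r)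
  ... | inj₂ p-unit = ⊥-elim (irreducible-nonunit p-irr p-unit)
  ... | inj₁ u-unit with deg≡0⇒const (∣-nonzero (∣ₚ⇒∣ u-unit) 1ₚ≉0) (unit⇒deg≡0 u-unit)
  ...   | c , c≢0 , u≋c = begin
    xs ++ [ 1# ]              ≡⟨ ≡.cong (_++ [ 1# ]) xs≡ ⟩
    scale c xs ++ [ 1# ]      ≡⟨ ≡.cong (_++ [ 1# ]) (proj₁ parts) ⟩
    ys ++ [ 1# ]              ∎
    where
    open ≡.≡-Reasoning
    c*1≡c : c K.* 1# ≡ c
    c*1≡c = K.*-identityʳ c
    scaled : scale c p ≡ scale c xs ++ [ c K.* 1# ]
    scaled = map-++ (c K.*_) xs [ 1# ]
    scaled≋ : scale c p ≋ ys ++ [ 1# ]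
    scaled≋ = ≋-trans (≋-sym (const-*ₚ c p)) (≋-trans (*ₚ-cong (≋-sym u≋c) ≋-refl) up≋r)
    parts : scale c xs ≡ ys × c K.* 1# ≡ 1#
    parts = ∷ʳ-injective (scale c xs) ys (snoc-≋-injective (scale c xs) ys (c≢0 ∘ ≡.trans (≡.sym c*1≡c)) 1≢0
      (≡.subst (_≋ ys ++ [ 1# ]) scaled scaled≋))
    xs≡ : xs ≡ scale c xs
    xs≡ = ≡.sym (map-id-local (All.tabulate λ {x} _ →
      ≡.trans (≡.cong (K._* x) (≡.trans (≡.sym c*1≡c) (proj₂ parts))) (K.*-identityˡ x)))

  -- One direction suffices: each prime only has to be comaximal with the product of the primes
  -- after it.
  PairwiseIndivisible : List Poly → Set
  PairwiseIndivisible = AllPairs (λ p r → ¬ p ∣ r)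

  prodₚ-∣ : ∀ {h ps} → All Irreducible ps → PairwiseIndivisible ps → All (_∣ h) ps → prodₚ ps ∣ h
  prodₚ-∣ {h} [] [] [] = h , A.*-identityʳ h
  prodₚ-∣ {h} {p ∷ ps} (irr ∷ irrs) (p∤ps ∷ indiv) (p∣h ∷ ps∣h) =
    comaximal-∣ {p} {prodₚ ps} (irreducible-comaximal irr (irreducible-∤prod irr p∤ps)) p∣h (prodₚ-∣ irrs indiv ps∣h)

  prodₚ-nonzero : ∀ {ps} → All Irreducible ps → ¬ prodₚ ps ≋ []
  prodₚ-nonzero []           = 1ₚ≉0
  prodₚ-nonzero (irr ∷ irrs) = *ₚ-nonzero (irreducible-nonzero irr) (prodₚ-nonzero irrs)

  -- The number of good tuples modulo a prime, a product of primes, and H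

  card-residues : ∀ {p} → ¬ p ≋ [] → Card (Mod p) ∣ p ∣ₚ
  card-residues {p} p≉0 = Remainder.residues (leading-deg p≉0) ⨾ flip (pow≅vec (deg p))
                        ⨾ card-pow (deg p) (card-complete elements elements-unique elements-complete)

  2≤q : 2 ≤ q
  2≤q = go elements (elements-complete 0#) (elements-complete 1#)
    where
    go : ∀ xs → 0# ∈ xs → 1# ∈ xs → 2 ≤ length xs
    go (_ ∷ [])    (here ≡.refl) (here e) = ⊥-elim (0≢1 (≡.sym e))
    go (_ ∷ _ ∷ _) _             _        = s≤s (s≤s z≤n)

  -- Having |P| - 1 in successor form keeps `inv` away from its default value at 0 and gives the
  -- recurrence its nonzero base.
  irreducible-norm : ∀ {p} → Irreducible p → ∃[ m ] ∣ p ∣ₚ ≡ suc (suc m)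
  irreducible-norm {p} irr = ∣ p ∣ₚ ℕ.∸ 2 , ≡.sym (ℕ.m+[n∸m]≡n (begin
    2              ≤⟨ 2≤q ⟩
    q              ≡⟨ ℕ.^-identityʳ q ⟨
    q ℕ.^ 1        ≤⟨ ℕ.^-monoʳ-≤ q {{ℕ.>-nonZero (ℕ.≤-trans (s≤s z≤n) 2≤q)}} 1≤deg ⟩
    q ℕ.^ deg p    ∎))
    where
    open ℕ.≤-Reasoning
    1≤deg : 1 ≤ deg p
    1≤deg = ℕ.n≢0⇒n>0 (irreducible-nonunit irr ∘ deg≡0⇒unit (irreducible-nonzero irr))

  local-factor : ℕ → Poly → ℚ
  local-factor k p = fromℕ (∣ p ∣ₚ ℕ.∸ 1) ^ℚ k ℚ.* altSum (inv (∣ p ∣ₚ ℕ.∸ 1)) k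

  count-good : ∀ {p} → Irreducible p → ∀ k → ∃[ g ] Card (Sub (Class p k) (Good p)) g × fromℕ g ≡ local-factor k p
  count-good {p} irr k with irreducible-norm irr
  ... | m , norm≡ = g k , cards k , ≡.subst (λ n → fromℕ (g k) ≡ fromℕ (n ℕ.∸ 1) ^ℚ k ℚ.* altSum (inv (n ℕ.∸ 1)) k)
      (≡.sym norm≡) (alternating-recurrence m g (card-good-0 p p∣? (cards 0))
                     (λ k → good-recurrence p p∣? k residues (cards k) (cards (suc k))) k)
    where
    p∣? : ∀ a → Dec (p ∣ a)
    p∣? = Remainder.multiple? (leading-deg (irreducible-nonzero irr))
    residues : Card (Mod p) (suc (suc m))
    residues = ≡.subst (Card (Mod p)) norm≡ (card-residues (irreducible-nonzero irr))
    g : ℕ → ℕ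
    g k = proj₁ (card-good p p∣? residues k)
    cards : ∀ k → Card (Sub (Class p k) (Good p)) (g k)
    cards k = proj₂ (card-good p p∣? residues k)

  GoodAll : ∀ {k} → List Poly → (Fin k → Poly) → Set
  GoodAll ps t = All (λ p → Good p t) ps

  good-all-resp : ∀ {k h ps} → All (_∣ h) ps → GoodAll {k} ps Respects[ h ]
  good-all-resp []           e []            = []
  good-all-resp (p∣h ∷ ps∣h) e (good ∷ goods) = good-resp _ (λ i → ≡-weaken p∣h (e i)) good ∷ good-all-resp ps∣h e goods

  ∣-prodₚ : ∀ ps → All (_∣ prodₚ ps) ps
  ∣-prodₚ []       = []
  ∣-prodₚ (p ∷ ps) = (prodₚ ps , A.*-comm (prodₚ ps) p) ∷ All.map (∣-*ˡ p) (∣-prodₚ ps)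

  count-good-all : ∀ {ps} → All Irreducible ps → PairwiseIndivisible ps → ∀ k →
                   ∃[ n ] Card (Sub (Class (prodₚ ps) k) (GoodAll ps)) n × fromℕ n ≡ prodℚ (map (local-factor k) ps)
  -- Modulo 1 all tuples are congruent and no condition is left, so the count is 1, the empty
  -- product.
  count-good-all [] [] k =
    1 , (contractible (Sub (Class 1ₚ k) (GoodAll [])) ((λ _ → 0ₚ) , []) (λ _ _ → ≡-mod-1 _ _) ⨾ card-⊤) , ≡.refl
  count-good-all {p ∷ ps} (irr ∷ irrs) (p∤ps ∷ indiv) k = combine (count-good irr k) (count-good-all irrs indiv k)
    where
    regroup : Sub (Class (p *ₚ prodₚ ps) k) (GoodAll (p ∷ ps)) ≅ Sub (Class (p *ₚ prodₚ ps) k) (λ t → Good p t × GoodAll ps t)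
    regroup = sub-cong {X = GoodAll (p ∷ ps)} (identity _) (λ { _ (good ∷ goods) → good , goods }) (λ { _ (good , goods) → good ∷ goods })
    split : Sub (Class (p *ₚ prodₚ ps) k) (λ t → Good p t × GoodAll ps t) ≅ Sub (Class p k) (Good p) ×ₛ Sub (Class (prodₚ ps) k) (GoodAll ps)
    split = chinese-remainder {p} {prodₚ ps} (irreducible-comaximal irr (irreducible-∤prod irr p∤ps)) {k} {Good p} {GoodAll ps}
      (good-resp p) (good-all-resp (∣-prodₚ ps))
    combine : ∃[ g ] Card (Sub (Class p k) (Good p)) g × fromℕ g ≡ local-factor k p →
              ∃[ n ] Card (Sub (Class (prodₚ ps) k) (GoodAll ps)) n × fromℕ n ≡ prodℚ (map (local-factor k) ps) →
              ∃[ n ] Card (Sub (Class (p *ₚ prodₚ ps) k) (GoodAll (p ∷ ps))) n × fromℕ n ≡ prodℚ (map (local-factor k) (p ∷ ps))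
    combine (g , c , g≡) (n , d , n≡) = g ℕ.* n , regroup ⨾ split ⨾ card-× c d , ≡.trans (fromℕ-* g n) (≡.cong₂ ℚ._*_ g≡ n≡)

  norm-* : ∀ {p r} → ¬ p ≋ [] → ¬ r ≋ [] → ∣ p *ₚ r ∣ₚ ≡ ∣ p ∣ₚ ℕ.* ∣ r ∣ₚ
  norm-* {p} {r} p≉0 r≉0 = ≡.trans (≡.cong (q ℕ.^_) (deg-* p≉0 r≉0)) (ℕ.^-distribˡ-+-* q (deg p) (deg r))

  norm-pred : ∀ {p} → Irreducible p → fromℕ ∣ p ∣ₚ ℚ.* (1ℚ ℚ.- inv ∣ p ∣ₚ) ≡ fromℕ (∣ p ∣ₚ ℕ.∸ 1)
  norm-pred {p} irr with irreducible-norm irr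
  ... | m , norm≡ = ≡.subst (λ n → fromℕ n ℚ.* (1ℚ ℚ.- inv n) ≡ fromℕ (n ℕ.∸ 1)) (≡.sym norm≡) (fromℕ-pred (suc m))

  -- The norm is multiplicative, so each |P| can be paired with its own factor 1 - 1/|P|, giving |P|
  -- - 1.
  eulerPhi-prodₚ : ∀ {ps} → All Irreducible ps →
                   eulerPhi (prodₚ ps) ps ≡ prodℚ (map (λ p → fromℕ (∣ p ∣ₚ ℕ.∸ 1)) ps)
  eulerPhi-prodₚ [] = ≡.trans (ℚ.*-identityʳ _) (≡.cong (λ d → fromℕ (q ℕ.^ d)) (deg-unique leading-1))
  eulerPhi-prodₚ {p ∷ ps} (irr ∷ irrs) = begin
    fromℕ ∣ p *ₚ prodₚ ps ∣ₚ ℚ.* (x ℚ.* X)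
      ≡⟨ ≡.cong (λ n → fromℕ n ℚ.* (x ℚ.* X)) (norm-* (irreducible-nonzero irr) (prodₚ-nonzero irrs)) ⟩
    fromℕ (∣ p ∣ₚ ℕ.* ∣ prodₚ ps ∣ₚ) ℚ.* (x ℚ.* X)
      ≡⟨ ≡.cong (ℚ._* (x ℚ.* X)) (fromℕ-* (∣ p ∣ₚ) (∣ prodₚ ps ∣ₚ)) ⟩
    fromℕ ∣ p ∣ₚ ℚ.* fromℕ ∣ prodₚ ps ∣ₚ ℚ.* (x ℚ.* X)
      ≡⟨ interchange (fromℕ ∣ p ∣ₚ) (fromℕ ∣ prodₚ ps ∣ₚ) x X ⟩
    fromℕ ∣ p ∣ₚ ℚ.* x ℚ.* (fromℕ ∣ prodₚ ps ∣ₚ ℚ.* X)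
      ≡⟨ ≡.cong₂ ℚ._*_ (norm-pred irr) (eulerPhi-prodₚ irrs) ⟩
    fromℕ (∣ p ∣ₚ ℕ.∸ 1) ℚ.* prodℚ (map (λ p → fromℕ (∣ p ∣ₚ ℕ.∸ 1)) ps) ∎
    where
    open ≡.≡-Reasoning
    open import Algebra.Properties.CommutativeSemigroup (CommutativeRing.*-commutativeSemigroup ℚ.+-*-commutativeRing) using (interchange)
    x X : ℚ
    x = 1ℚ ℚ.- inv ∣ p ∣ₚ
    X = prodℚ (map (λ p → 1ℚ ℚ.- inv ∣ p ∣ₚ) ps)

  -- The Euler function of h is |e| times the product of the |P| - 1; its k-th power supplies both
  -- |e|^k and the powers inside the local factors.
  rhs-factor : ∀ {h e ps} → All Irreducible ps → ¬ h ≋ [] → h ≋ e *ₚ prodₚ ps → ∀ k →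
               prodℚ (map (local-factor k) ps) ℚ.* fromℕ (∣ e ∣ₚ ℕ.^ k) ≡ rhs h ps k
  rhs-factor {h} {e} {ps} irrs h≉0 h≋ k = begin
    prodℚ (map (local-factor k) ps) ℚ.* fromℕ (∣ e ∣ₚ ℕ.^ k)
      ≡⟨ ≡.cong₂ ℚ._*_ (prodℚ-^-* _ _ k ps) (fromℕ-^ (∣ e ∣ₚ) k) ⟩
    M ^ℚ k ℚ.* S ℚ.* E ^ℚ k
      ≡⟨ xy∙z≈zx∙y (M ^ℚ k) S (E ^ℚ k) ⟩
    E ^ℚ k ℚ.* M ^ℚ k ℚ.* S
      ≡⟨ ≡.cong (ℚ._* S) (^ℚ-distrib-* E M k) ⟨
    (E ℚ.* M) ^ℚ k ℚ.* S
      ≡⟨ ≡.cong (λ φ → φ ^ℚ k ℚ.* S) φ≡ ⟨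
    rhs h ps k ∎
    where
    open ≡.≡-Reasoning
    open import Algebra.Properties.CommutativeSemigroup (CommutativeRing.*-commutativeSemigroup ℚ.+-*-commutativeRing) using (xy∙z≈zx∙y)
    M S E X : ℚ
    M = prodℚ (map (λ p → fromℕ (∣ p ∣ₚ ℕ.∸ 1)) ps)
    S = prodℚ (map (λ p → altSum (inv (∣ p ∣ₚ ℕ.∸ 1)) k) ps)
    E = fromℕ ∣ e ∣ₚ
    X = prodℚ (map (λ p → 1ℚ ℚ.- inv ∣ p ∣ₚ) ps)
    e≉0 : ¬ e ≋ []
    e≉0 = ∣-nonzero (prodₚ ps , A.trans (A.*-comm (prodₚ ps) e) (A.sym h≋)) h≉0
    φ≡ : eulerPhi h ps ≡ E ℚ.* M
    φ≡ = begin
      fromℕ ∣ h ∣ₚ ℚ.* X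
        ≡⟨ ≡.cong (λ n → fromℕ n ℚ.* X) (≡.trans (≡.cong (q ℕ.^_) (deg-cong h≉0 h≋)) (norm-* e≉0 (prodₚ-nonzero irrs))) ⟩
      fromℕ (∣ e ∣ₚ ℕ.* ∣ prodₚ ps ∣ₚ) ℚ.* X
        ≡⟨ ≡.cong (ℚ._* X) (fromℕ-* (∣ e ∣ₚ) (∣ prodₚ ps ∣ₚ)) ⟩
      E ℚ.* fromℕ ∣ prodₚ ps ∣ₚ ℚ.* X
        ≡⟨ ℚ.*-assoc E _ X ⟩
      E ℚ.* (fromℕ ∣ prodₚ ps ∣ₚ ℚ.* X)
        ≡⟨ ≡.cong (E ℚ.*_) (eulerPhi-prodₚ irrs) ⟩
      E ℚ.* M ∎

  count-good-mod : ∀ {h ps} → All Irreducible ps → PairwiseIndivisible ps → All (_∣ h) ps → ¬ h ≋ [] → ∀ k →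
                   ∃[ n ] Card (Sub (Class h k) (GoodAll ps)) n × fromℕ n ≡ rhs h ps k
  count-good-mod {h} {ps} irrs indiv ps∣h h≉0 k = combine (prodₚ-∣ irrs indiv ps∣h) (count-good-all irrs indiv k)
    where
    d : Poly
    d = prodₚ ps
    d≉0 : ¬ d ≋ []
    d≉0 = prodₚ-nonzero irrs
    open Remainder (leading-deg d≉0)

    factor : ∀ e → d *ₚ e ≋ h → Sub (Class h k) (GoodAll ps) ≅ Sub (Class (d *ₚ e) k) (GoodAll ps)
    factor e de≋h = sub-cong (class-cong (A.sym de≋h)) (λ _ x → x) (λ _ x → x)

    split : ∀ e → Sub (Class (d *ₚ e) k) (GoodAll ps) ≅ Sub (Class d k) (GoodAll ps) ×ₛ Class e k
    -- The remainder modulo d serves as representative: congruent polynomials have the same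
    -- remainder vector.
    split e = refine d (*ₚ-cancelʳ d≉0) (toList ∘ rem) rem-≡ (λ a≡b → A.reflexive (≡.cong toList (rem-cong a≡b))) e
                     (good-all-resp (∣-prodₚ ps))

    combine : d ∣ h → ∃[ n ] Card (Sub (Class d k) (GoodAll ps)) n × fromℕ n ≡ prodℚ (map (local-factor k) ps) →
              ∃[ n ] Card (Sub (Class h k) (GoodAll ps)) n × fromℕ n ≡ rhs h ps k
    combine (e , ed≋h) (n , c , n≡) = n ℕ.* ∣ e ∣ₚ ℕ.^ k
      , factor e de≋h ⨾ split e ⨾ card-× c (card-pow k (card-residues (∣-nonzero (d , de≋h) h≉0)))
      , ≡.trans (fromℕ-* n (∣ e ∣ₚ ℕ.^ k))
          (≡.trans (≡.cong (ℚ._* fromℕ (∣ e ∣ₚ ℕ.^ k)) n≡) (rhs-factor {e = e} irrs h≉0 (A.sym ed≋h) k))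
      where
      de≋h : d *ₚ e ≋ h
      de≋h = A.trans (A.*-comm d e) ed≋h

  -- From conditions at the primes to coprimality with H

  module _ {h : Poly} (h≉0 : ¬ h ≋ []) {ps : List Poly} (primes : PrimeDivisors h ps) where

    private
      prime : ∀ {p} → p ∈ ps → Monic p × Irreducible p × p ∣ₚ h
      prime {p} = proj₁ (proj₂ primes p)

    primes-irreducible : All Irreducible ps
    primes-irreducible = All.tabulate (λ p∈ → proj₁ (proj₂ (prime p∈)))

    primes-∣ : All (_∣ h) ps
    primes-∣ = All.tabulate (λ p∈ → ∣ₚ⇒∣ (proj₂ (proj₂ (prime p∈))))

    -- Divisibility between two listed primes would make them equal, against `Unique`. The induction
    -- runs over tails of the list, and `incl` remembers that their entries come from ps.
    primes-indivisible : PairwiseIndivisible ps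
    primes-indivisible = go (proj₁ primes) (λ p∈ → p∈)
      where
      go : ∀ {rs} → Unique rs → (∀ {p} → p ∈ rs → p ∈ ps) → PairwiseIndivisible rs
      go []           _    = []
      go (p∉rs ∷ urs) incl = All.tabulate (λ r∈ p∣r → All.lookup p∉rs r∈ (equal (prime (incl (here ≡.refl))) (prime (incl (there r∈))) p∣r))
                           ∷ go urs (incl ∘ there)
        where
        equal : ∀ {p r} → Monic p × Irreducible p × p ∣ₚ h → Monic r × Irreducible r × r ∣ₚ h → p ∣ r → p ≡ r
        equal (p-monic , p-irr , _) (r-monic , r-irr , _) = monic-irreducible-∣ p-monic p-irr r-monic r-irr

    coprime⇒∤ : ∀ {a} → Coprime a h → All (λ p → ¬ p ∣ a) ps
    coprime⇒∤ coprime = All.tabulate (λ {p} p∈ p∣a → let (_ , irr , p∣h) = prime p∈ in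
      irreducible-nonunit irr (coprime p (∣⇒∣ₚ p∣a) p∣h))

    -- If a common divisor d were a nonunit, any irreducible divisor of d would have a monic
    -- associate in the list, and that prime would divide a. The goal is decidable, so it does no
    -- harm that the irreducible divisor exists only up to double negation.
    ∤⇒coprime : ∀ {a} → All (λ p → ¬ p ∣ a) ps → Coprime a h
    ∤⇒coprime {a} ps∤a d d∣a d∣h with ∣-nonzero (∣ₚ⇒∣ d∣h) h≉0
    ... | d≉0 with unit? d≉0
    ...   | yes d-unit   = d-unit
    ...   | no d-nonunit = ⊥-elim (irreducible-divisor (<-wellFounded _) d≉0 d-nonunit none)
      where
      none : ∀ r → Irreducible r → ¬ r ∣ d
      none r r-irr r∣d with monic-associate (irreducible-nonzero r-irr)
      ... | m , m-monic , m∣r , r∣m = All.lookup ps∤a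
        (proj₂ (proj₂ primes m) (m-monic , irreducible-associate r-irr r∣m m∣r , ∣⇒∣ₚ (∣-trans (∣-trans m∣r r∣d) (∣ₚ⇒∣ d∣h))))
        (∣-trans (∣-trans m∣r r∣d) (∣ₚ⇒∣ d∣a))

    representative : ∀ {k} → Vec (Residue h) k → Fin k → Poly
    representative v i = toList (Vec.lookup v i)

    ∣prod : ∀ {p k} (v : Vec (Residue h) k) i → p ∣ representative v i → p ∣ prodₚ (map toList (toList v))
    ∣prod (x ∷ v) zero    p∣x = ∣-*ʳ (prodₚ (map toList (toList v))) p∣x
    ∣prod (x ∷ v) (suc i) p∣  = ∣-*ˡ (toList x) (∣prod v i p∣)

    avoids⇒All : ∀ {p k} (v : Vec (Residue h) k) → Avoids p (representative v) → All (λ r → ¬ p ∣ r) (map toList (toList v))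
    avoids⇒All []      av = []
    avoids⇒All (x ∷ v) av = av zero ∷ avoids⇒All v (av ∘ suc)

    sum-representative : ∀ {k} (v : Vec (Residue h) k) → sum (representative v) ≡ sumₚ (map toList (toList v))
    sum-representative []      = ≡.refl
    sum-representative (x ∷ v) = ≡.cong (toList x +ₚ_) (sum-representative v)

    -- For the product this is Euclid's lemma: a prime dividing no entry does not divide the
    -- product. The converse, `cond⇒good`, only needs that an entry divides the product.
    good⇒cond : ∀ {k} (v : Vec (Residue h) k) → GoodAll ps (representative v) → PhiKCond h k v
    good⇒cond v goods =
        ∤⇒coprime (All.zipWith (λ (irr , av , _) → irreducible-∤prod irr (avoids⇒All v av)) (primes-irreducible , goods))
      , ∤⇒coprime (All.map (λ (_ , p∤Σ) → p∤Σ ∘ ≡.subst (_ ∣_) (≡.sym (sum-representative v))) goods)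

    cond⇒good : ∀ {k} (v : Vec (Residue h) k) → PhiKCond h k v → GoodAll ps (representative v)
    cond⇒good v (prod-coprime , sum-coprime) = All.zipWith
      (λ (p∤Π , p∤Σ) → (λ i p∣ → p∤Π (∣prod v i p∣)) , p∤Σ ∘ ≡.subst (_ ∣_) (sum-representative v))
      (coprime⇒∤ prod-coprime , coprime⇒∤ sum-coprime)

    good≅cond : ∀ k → Sub (Class h k) (GoodAll ps) ≅ Sub (≡.setoid (Vec (Residue h) k)) (PhiKCond h k)
    good≅cond k = sub-cong tuples
      -- The tuple t and its remainders are congruent modulo h, hence modulo every listed prime, so
      -- goodness passes to the remainders.
      (λ t goods → good⇒cond (to t) (good-all-resp primes-∣ (Setoid.sym (Class h k) (inverseʳ {t} ≡.refl)) goods))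
      cond⇒good
      where
      tuples : Class h k ≅ ≡.setoid (Vec (Residue h) k)
      tuples = pow-cong k (Remainder.residues (leading-deg h≉0)) ⨾ pow≅vec k
      open Inverse tuples

  -- The list enumerates the inverse of the bijection. Equality in `Sub` concerns the tuples alone,
  -- so injectivity of the inverse is exactly the absence of repetitions.
  card⇒phiKIs : ∀ {h k n} → Card (Sub (≡.setoid (Vec (Residue h) k)) (PhiKCond h k)) n → PhiKIs h k n
  card⇒phiKIs {h} {k} {n} c = List.tabulate tuple
    , tabulate⁺ (λ {i} {j} e → ≡.trans (≡.sym (inverseˡ {i} {from i} ≡.refl)) (inverseˡ {j} {from i} e))
    , (λ t → (λ t∈ → let (i , e) = ∈-tabulate⁻ t∈ in ≡.subst (PhiKCond h k) (≡.sym e) (proj₂ (from i)))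
           , (λ cond → ≡.subst (_∈ List.tabulate tuple) (inverseʳ {t , cond} ≡.refl) (∈-tabulate⁺ (to (t , cond)))))
    , length-tabulate tuple
    where
    open Inverse c
    tuple : Fin n → Vec (Residue h) k
    tuple i = proj₁ (from i)

  phi-formula : (H : Poly) → ¬ (Poly._≈ₚ_ F H 0ₚ) → (k : ℕ) →
         (Ps : List Poly) → PrimeDivisors H Ps → ∃[ n ] (PhiKIs H k n × fromℕ n ≡ rhs H Ps k)
  phi-formula H H≉0 k Ps primes =
    combine (count-good-mod (primes-irreducible H≉0′ primes) (primes-indivisible H≉0′ primes) (primes-∣ H≉0′ primes) H≉0′ k)
    where
    H≉0′ : ¬ H ≋ []
    H≉0′ e = H≉0 (≋⇒≈ₚ e)
    combine : ∃[ n ] Card (Sub (Class H k) (GoodAll Ps)) n × fromℕ n ≡ rhs H Ps k → ∃[ n ] (PhiKIs H k n × fromℕ n ≡ rhs H Ps k)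
    combine (n , c , n≡) = n , card⇒phiKIs (flip (good≅cond H≉0′ primes k) ⨾ c) , n≡

theorem1p1 : (F : FiniteField) (H : Poly.Poly F) → ¬ (Poly._≈ₚ_ F H (Poly.0ₚ F))
    → (k : ℕ) → 1 ≤ k
    → (Ps : List (Poly.Poly F)) → Poly.PrimeDivisors F H Ps
    → ∃[ n ] (Poly.PhiKIs F H k n × fromℕ n ≡ Formula.rhs F H Ps k)
theorem1p1 F H H≉0 k _ Ps primes = Counting.phi-formula F H H≉0 k Ps primes
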